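{- Let $\ell\ge 2$. Suppose that $\lambda$ is an $\ell$-partition and $0\le i<\ell$. Write $\varphi=\varphi_i(\lambda)$ and $\varepsilon=\varepsilon_i(\lambda)$. Then 1. $\widetilde f_i^{\,k}\lambda$ is not an $\ell$-partition for $0<k<\varphi-1$; 2. $\widetilde e_i^{\,k}\lambda$ is not an $\ell$-partition for $1<k<\varepsilon$.
   Context: A partition is $\ell$-regular if it does not have $\ell$ or more equal nonzero parts. A removable $\ell$-rim hook (for short, $\ell$-rim hook) of $\lambda$ is a connected sequence of $\ell$ boxes of the Young diagram of $\lambda$, containing no $2\times2$ square, whose removal from $\lambda$ leaves the Young diagram of a partition. It is horizontal if all its boxes lie in one row, and non-horizontal otherwise. An $\ell$-partition is an $\ell$-regular partition which has no non-horizontal $\ell$-rim hooks and such that, after removing any number of horizontal $\ell$-rim hooks in any order, the remaining diagram has no non-horizontal $\ell$-rim hooks. Crystal $B(\Lambda_0)$ of $\widehat{\mathfrak{sl}_\ell}$ (nodes: the $\ell$-regular partitions). The position in row $a$, column $b$ has residue $b-a \bmod \ell$. A box $x$ of $\lambda$ is a removable $i$-box if it has residue $i$ and $\lambda\setminus x$ is a partition; a position $y\notin\lambda$ is an addable $i$-box if it has residue $i$ and $\lambda\cup y$ is a partition. Put $-$ in each removable $i$-box and $+$ in each addable $i$-box. The $i$-signature of $\lambda$ is the word of $+$'s and $-$'s read from bottom left to top right; the reduced $i$-signature is obtained by repeatedly deleting adjacent pairs $-+$, giving a word $+\cdots+-\cdots-$. Boxes of the remaining $-$'s are the normal $i$-boxes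 and boxes of the remaining $+$'s are the conormal $i$-boxes; $\varepsilon_i(\lambda)$ and $\varphi_i(\lambda)$ are their respective numbers. The good $i$-box is the one of the leftmost remaining $-$; the cogood $i$-box is the one of the rightmost remaining $+$. $\widetilde e_i\lambda$ is $\lambda$ with its good $i$-box removed (or $0$ if there is none), and $\widetilde f_i\lambda$ is $\lambda$ with its cogood $i$-box added (or $0$ if there is none). -}

module Defs where

open import Data.Nat.Base using (ℕ; zero; suc; _+_; _≤_; _<_; _≥_; z≤n; s≤s; ∣_-_∣; NonZero)
open import Data.Nat.Properties
open import Data.Integer.Base using (+_) renaming (_-_ to _-ℤ_)
open import Data.Integer.DivMod using (_%ℕ_)
open import Data.List.Base
  using (List; []; _∷_; _++_; length; filter; foldr; head; last; mapMaybe; cartesianProduct; upTo; downFrom)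
open import Data.List.Relation.Unary.All using (All; []; _∷_)
open import Data.List.Relation.Unary.Linked using (Linked; []; [-]; _∷_)
open import Data.List.Relation.Unary.Unique.Propositional using (Unique)
open import Data.List.Membership.Propositional using () renaming (_∈_ to _∈ˡ_)
open import Data.Maybe.Base as Maybe using (Maybe; just; nothing; _>>=_)
open import Data.Product using (Σ; ∃; ∃₂; _×_; _,_; proj₁; proj₂)
open import Data.Sum.Base using (_⊎_; inj₁; inj₂)
open import Data.Unit.Base using (⊤; tt)
open import Function.Base using (_∘_)
open import Function.Bundles using (_⇔_; mk⇔; Equivalence)
open import Relation.Binary.Construct.Closure.ReflexiveTransitive using (Star; ε; _◅_; _◅◅_; gmap)
open import Relation.Binary.PropositionalEquality
open import Relation.Nullary using (¬_; Dec; yes; no; contradiction)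
open import Relation.Nullary.Decidable using (map′; _×-dec_; _⊎-dec_)

open Equivalence using (to; from)

------------------------------------------------------------------------
-- Partitions and Young diagrams

record Partition : Set where
  constructor partition
  field
    parts      : List ℕ
    decreasing : Linked _≥_ parts
    positive   : All (0 <_) parts

open Partition public

-- Rows and columns are numbered from 0; b - a is unaffected by this shift.
Box : Set
Box = ℕ × ℕ

rowLength : List ℕ → ℕ → ℕ
rowLength []       _       = 0
rowLength (p ∷ _)  zero    = p
rowLength (_ ∷ ps) (suc a) = rowLength ps a

row : Partition → ℕ → ℕ
row = rowLength ∘ parts

infix 4 _∈_
_∈_ : Box → Partition → Set
(a , b) ∈ ν = b < row ν a

_≐_∖_ : Partition → Partition → (Box → Set) → Set
μ ≐ ν ∖ P = ∀ y → y ∈ μ ⇔ (y ∈ ν × ¬ P y)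

_≐_∪_ : Partition → Partition → (Box → Set) → Set
μ ≐ ν ∪ P = ∀ y → y ∈ μ ⇔ (y ∈ ν ⊎ P y)

Regular : ℕ → Partition → Set
Regular ℓ ν = ∀ n → 0 < n → length (filter (n ≟_) (parts ν)) < ℓ

------------------------------------------------------------------------
-- Rim hooks and ℓ-partitions

-- The two boxes share an edge.
Adjacent : Box → Box → Set
Adjacent (a , b) (c , d) = ∣ a - c ∣ + ∣ b - d ∣ ≡ 1

record RimHook (ℓ : ℕ) (ν : Partition) : Set where
  field
    boxes     : List Box
    size      : length boxes ≡ ℓ
    distinct  : Unique boxes
    connected : Linked Adjacent boxes
    inside    : All (_∈ ν) boxes
    no-2×2    : ∀ a b → ¬ ((a , b) ∈ˡ boxes × (a , suc b) ∈ˡ boxes ×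
                           (suc a , b) ∈ˡ boxes × (suc a , suc b) ∈ˡ boxes)
    rest      : Partition
    removed   : rest ≐ ν ∖ (_∈ˡ boxes)

open RimHook public

Horizontal : ∀ {ℓ ν} → RimHook ℓ ν → Set
Horizontal h = ∃ λ a → All (λ x → proj₁ x ≡ a) (boxes h)

NoNonHorizontalHook : ℕ → Partition → Set
NoNonHorizontalHook ℓ ν = ¬ (Σ (RimHook ℓ ν) λ h → ¬ Horizontal h)

RemoveHorizontalHook : ℕ → Partition → Partition → Set
RemoveHorizontalHook ℓ ν μ = Σ (RimHook ℓ ν) λ h → Horizontal h × rest h ≡ μ

record IsℓPartition (ℓ : ℕ) (ν : Partition) : Set where
  field
    regular       : Regular ℓ ν
    noHook        : NoNonHorizontalHook ℓ ν
    noHookRemoved : ∀ μ → Star (RemoveHorizontalHook ℓ) ν μ → NoNonHorizontalHook ℓ μ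

------------------------------------------------------------------------
-- Removable and addable boxes

Removable : Partition → Box → Set
Removable ν x = x ∈ ν × ∃ λ μ → μ ≐ ν ∖ (_≡ x)

Addable : Partition → Box → Set
Addable ν x = ¬ (x ∈ ν) × ∃ λ μ → μ ≐ ν ∪ (_≡ x)

-- Any weakly decreasing, eventually zero function is the row-length function
-- of a partition.
fromRows : (f : ℕ → ℕ) → (∀ a → f (suc a) ≤ f a) → ∀ m → f m ≡ 0 →
           Σ Partition λ μ → ∀ a → row μ a ≡ f a
fromRows f dec m fm≡0 = let (ps , d , p , e) = go f dec m fm≡0 in partition ps d p , e
  where
  vanish : (f : ℕ → ℕ) → (∀ a → f (suc a) ≤ f a) → f 0 ≡ 0 → ∀ a → 0 ≡ f a
  vanish f dec f0 zero    = sym f0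
  vanish f dec f0 (suc a) = sym (n≤0⇒n≡0 (≤-trans (dec a) (≤-reflexive (sym (vanish f dec f0 a)))))

  link : ∀ {n} ps → rowLength ps 0 ≤ n → Linked _≥_ ps → Linked _≥_ (n ∷ ps)
  link []       _ _ = [-]
  link (_ ∷ _) le d = le ∷ d

  go : (f : ℕ → ℕ) → (∀ a → f (suc a) ≤ f a) → ∀ m → f m ≡ 0 →
       Σ (List ℕ) λ ps → Linked _≥_ ps × All (0 <_) ps × (∀ a → rowLength ps a ≡ f a)
  go f dec zero    fm = [] , [] , [] , vanish f dec fm
  go f dec (suc m) fm with f 0 ≟ 0
  ... | yes f0 = [] , [] , [] , vanish f dec f0
  ... | no f0≢0 with go (f ∘ suc) (dec ∘ suc) m fm
  ...   | ps , d , p , e =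
          f 0 ∷ ps , link ps (≤-trans (≤-reflexive (e 0)) (dec 0)) d , n≢0⇒n>0 f0≢0 ∷ p ,
          λ { zero → refl ; (suc a) → e a }

rowLength-dec : ∀ {ps} → Linked _≥_ ps → ∀ a → rowLength ps (suc a) ≤ rowLength ps a
rowLength-dec []       a       = z≤n
rowLength-dec [-]      zero    = z≤n
rowLength-dec [-]      (suc a) = z≤n
rowLength-dec (ge ∷ d) zero    = ge
rowLength-dec (ge ∷ d) (suc a) = rowLength-dec d a

rowLength-end : ∀ ps n → rowLength ps (length ps + n) ≡ 0
rowLength-end []       n = refl
rowLength-end (_ ∷ ps) n = rowLength-end ps n

row-dec : ∀ ν a → row ν (suc a) ≤ row ν a
row-dec ν = rowLength-dec (decreasing ν)

-- The row lengths after setting row a to length r.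
update : (ℕ → ℕ) → ℕ → ℕ → ℕ → ℕ
update f a r c with c ≟ a
... | yes _ = r
... | no  _ = f c

update-≡ : ∀ f a r → update f a r a ≡ r
update-≡ f a r with a ≟ a
... | yes _  = refl
... | no a≢a = contradiction refl a≢a

update-≢ : ∀ f a r {c} → c ≢ a → update f a r c ≡ f c
update-≢ f a r {c} c≢a with c ≟ a
... | yes c≡a = contradiction c≡a c≢a
... | no  _   = refl

update-dec : ∀ f a r → (∀ c → f (suc c) ≤ f c) → f (suc a) ≤ r →
             (∀ c → suc c ≡ a → r ≤ f c) → ∀ c → update f a r (suc c) ≤ update f a r c
update-dec f a r dec lo hi c with suc c ≟ a | c ≟ a
... | yes p    | yes refl = contradiction p 1+n≢n
... | yes p    | no  _    = hi c p
... | no  _    | yes refl = lo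
... | no  _    | no  _    = dec c

setRow : ∀ ν a r → row ν (suc a) ≤ r → (∀ c → suc c ≡ a → r ≤ row ν c) →
         Σ Partition λ μ → ∀ c → row μ c ≡ update (row ν) a r c
setRow ν a r lo hi =
  fromRows (update (row ν) a r) (update-dec (row ν) a r (row-dec ν) lo hi)
    (length (parts ν) + suc a)
    (trans (update-≢ (row ν) a r (λ p → length+suc≢ (length (parts ν)) p))
           (rowLength-end (parts ν) (suc a)))
  where
  length+suc≢ : ∀ m {n} → m + suc n ≢ n
  length+suc≢ m {n} p = <-irrefl (sym p) (m≤n+m (suc n) m)

CornerOut : Partition → Box → Set
CornerOut ν (a , b) = row ν a ≡ suc b × row ν (suc a) ≤ b

LongerAbove : Partition → ℕ → ℕ → Set
LongerAbove ν zero    b = ⊤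
LongerAbove ν (suc c) b = b < row ν c

CornerIn : Partition → Box → Set
CornerIn ν (a , b) = row ν a ≡ b × LongerAbove ν a b

corner⇒removable : ∀ ν x → CornerOut ν x → Removable ν x
corner⇒removable ν (a , b) (eq , lo)
  with setRow ν a b lo (λ { c refl → ≤-trans (n≤1+n b) (≤-trans (≤-reflexive (sym eq)) (row-dec ν c)) })
... | μ , e = ≤-reflexive (sym eq) , μ , λ y → mk⇔ (f y) (g y)
  where
  f : ∀ y → y ∈ μ → y ∈ ν × y ≢ (a , b)
  f (c , d) y∈ with c ≟ a
  ... | yes refl = ≤-trans (m≤n⇒m≤1+n d<b) (≤-reflexive (sym eq)) , λ { refl → <-irrefl refl d<b }
    where
    d<b : d < b
    d<b = ≤-trans y∈ (≤-reflexive (trans (e c) (update-≡ (row ν) c b)))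
  ... | no c≢a = ≤-trans y∈ (≤-reflexive (trans (e c) (update-≢ (row ν) a b c≢a))) ,
                 λ { refl → c≢a refl }
  g : ∀ y → y ∈ ν × y ≢ (a , b) → y ∈ μ
  g (c , d) (y∈ , y≢) with c ≟ a
  ... | yes refl = ≤-trans (≤∧≢⇒< (≤-pred (≤-trans y∈ (≤-reflexive eq))) (λ { refl → y≢ refl }))
                     (≤-reflexive (sym (trans (e c) (update-≡ (row ν) c b))))
  ... | no c≢a = ≤-trans y∈ (≤-reflexive (sym (trans (e c) (update-≢ (row ν) a b c≢a))))

removable⇒corner : ∀ ν x → Removable ν x → CornerOut ν x
removable⇒corner ν x@(a , b) (x∈ , μ , e) = ≤-antisym (≮⇒≥ right) x∈ , ≮⇒≥ below
  where
  x∉μ : ¬ (x ∈ μ)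
  x∉μ x∈μ = proj₂ (to (e x) x∈μ) refl
  right : ¬ (suc b < row ν a)
  right p = x∉μ (<-trans (n<1+n b) (from (e (a , suc b)) (p , λ ())))
  below : ¬ (b < row ν (suc a))
  below p = x∉μ (≤-trans (from (e (suc a , b)) (p , λ ())) (row-dec μ a))

removable? : ∀ ν x → Dec (Removable ν x)
removable? ν x@(a , b) = map′ (corner⇒removable ν x) (removable⇒corner ν x)
  ((row ν a ≟ suc b) ×-dec (row ν (suc a) ≤? b))

corner⇒addable : ∀ ν x → CornerIn ν x → Addable ν x
corner⇒addable ν (a , b) (eq , fits)
  with setRow ν a (suc b) (≤-trans (row-dec ν a) (≤-trans (≤-reflexive eq) (n≤1+n b)))
                          (λ { c refl → fits })
... | μ , e = (λ p → <-irrefl (sym eq) p) , μ , λ y → mk⇔ (f y) (g y)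
  where
  f : ∀ y → y ∈ μ → y ∈ ν ⊎ y ≡ (a , b)
  f (c , d) y∈ with c ≟ a
  ... | no c≢a = inj₁ (≤-trans y∈ (≤-reflexive (trans (e c) (update-≢ (row ν) a (suc b) c≢a))))
  ... | yes refl with d ≟ b
  ...   | yes refl = inj₂ refl
  ...   | no d≢b   = inj₁ (≤-trans (≤∧≢⇒< (≤-pred d<1+b) d≢b) (≤-reflexive (sym eq)))
    where
    d<1+b : d < suc b
    d<1+b = ≤-trans y∈ (≤-reflexive (trans (e c) (update-≡ (row ν) c (suc b))))
  g : ∀ y → y ∈ ν ⊎ y ≡ (a , b) → y ∈ μ
  g (c , d) (inj₂ refl) = ≤-reflexive (sym (trans (e c) (update-≡ (row ν) c (suc b))))
  g (c , d) (inj₁ y∈) with c ≟ a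
  ... | yes refl = ≤-trans (≤-trans y∈ (≤-trans (≤-reflexive eq) (n≤1+n b)))
                     (≤-reflexive (sym (trans (e c) (update-≡ (row ν) c (suc b)))))
  ... | no c≢a = ≤-trans y∈ (≤-reflexive (sym (trans (e c) (update-≢ (row ν) a (suc b) c≢a))))

addable⇒corner : ∀ ν x → Addable ν x → CornerIn ν x
addable⇒corner ν x@(a , b) (x∉ , μ , e) = ≤-antisym (≮⇒≥ x∉) (left b refl) , fits a refl
  where
  x∈μ : x ∈ μ
  x∈μ = from (e x) (inj₂ refl)
  left : ∀ d → b ≡ d → d ≤ row ν a
  left zero    _    = z≤n
  left (suc d) refl with to (e (a , d)) (<-trans (n<1+n d) x∈μ)
  ... | inj₁ p = p
  fits : ∀ a′ → a ≡ a′ → LongerAbove ν a′ b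
  fits zero    _    = tt
  fits (suc c) refl with to (e (c , b)) (≤-trans x∈μ (row-dec μ c))
  ... | inj₁ p = p

addable? : ∀ ν x → Dec (Addable ν x)
addable? ν x@(a , b) = map′ (corner⇒addable ν x) (addable⇒corner ν x)
  ((row ν a ≟ b) ×-dec longerAbove? a)
  where
  longerAbove? : ∀ a → Dec (LongerAbove ν a b)
  longerAbove? zero    = yes tt
  longerAbove? (suc c) = b <? row ν c

------------------------------------------------------------------------
-- Signatures

residue : (ℓ : ℕ) .{{_ : NonZero ℓ}} → Box → ℕ
residue ℓ (a , b) = (+ b -ℤ + a) %ℕ ℓ

-- A letter of a signature, together with the box it is written in.
data Letter (ν : Partition) : Set where
  minus : ∀ x → Removable ν x → Letter ν
  plus  : ∀ x → Addable ν x → Letter ν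

Word : Partition → Set
Word ν = List (Letter ν)

-- All the positions that can be removable or addable, from the bottom row to
-- the top row and from left to right within a row.
positions : Partition → List Box
positions ν = cartesianProduct (downFrom (suc (length (parts ν)))) (upTo (suc (row ν 0)))

module _ (ℓ : ℕ) .{{_ : NonZero ℓ}} (i : ℕ) where

  letter : ∀ ν → Box → Maybe (Letter ν)
  letter ν x with residue ℓ x ≟ i | removable? ν x | addable? ν x
  ... | no _  | _     | _     = nothing
  ... | yes _ | yes r | _     = just (minus x r)
  ... | yes _ | no _  | yes a = just (plus x a)
  ... | yes _ | no _  | no _  = nothing

  signature : ∀ ν → Word ν
  signature ν = mapMaybe (letter ν) (positions ν)

module _ {ν : Partition} where

  cancel : Letter ν → Word ν → Word ν
  cancel (minus _ _) (plus _ _ ∷ w) = w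
  cancel s           w              = s ∷ w

  reduce : Word ν → Word ν
  reduce = foldr cancel []

  minuses : Word ν → List (Σ Box (Removable ν))
  minuses = mapMaybe λ { (minus x r) → just (x , r) ; (plus _ _) → nothing }

  pluses : Word ν → List (Σ Box (Addable ν))
  pluses = mapMaybe λ { (minus _ _) → nothing ; (plus x a) → just (x , a) }

  -- reduce w is obtained from w by repeatedly deleting adjacent pairs -+
  -- (reduce-deletes) and has the form +⋯+-⋯- (reduce-sorted).
  data _⟶_ : Word ν → Word ν → Set where
    delete : ∀ {x y r a w} → (minus x r ∷ plus y a ∷ w) ⟶ w
    there  : ∀ {s w w′} → w ⟶ w′ → (s ∷ w) ⟶ (s ∷ w′)

  reduce-deletes : ∀ w → Star _⟶_ w (reduce w)
  reduce-deletes []      = ε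
  reduce-deletes (s ∷ w) = gmap (s ∷_) there (reduce-deletes w) ◅◅ step s (reduce w)
    where
    step : ∀ s w → Star _⟶_ (s ∷ w) (cancel s w)
    step (minus _ _) (plus _ _ ∷ w)    = delete ◅ ε
    step (minus _ _) []                = ε
    step (minus _ _) (minus _ _ ∷ _)   = ε
    step (plus _ _)  w                 = ε

  data Sorted : Word ν → Set where
    pluses-done : ∀ {w} → All (λ s → ∃₂ λ x r → s ≡ minus x r) w → Sorted w
    plus∷       : ∀ {x a w} → Sorted w → Sorted (plus x a ∷ w)

  reduce-sorted : ∀ w → Sorted (reduce w)
  reduce-sorted []      = pluses-done []
  reduce-sorted (s ∷ w) = step s (reduce-sorted w)
    where
    step : ∀ s {w} → Sorted w → Sorted (cancel s w)
    step (plus _ _)  d                                   = plus∷ d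
    step (minus _ _) (plus∷ d)                           = d
    step (minus x r) (pluses-done [])                    = pluses-done ((x , r , refl) ∷ [])
    step (minus x r) (pluses-done ((y , q , refl) ∷ ms)) =
      pluses-done ((x , r , refl) ∷ (y , q , refl) ∷ ms)

------------------------------------------------------------------------
-- Crystal operators

module _ (ℓ : ℕ) .{{_ : NonZero ℓ}} (i : ℕ) where

  normal : ∀ ν → List (Σ Box (Removable ν))
  normal ν = minuses (reduce (signature ℓ i ν))

  conormal : ∀ ν → List (Σ Box (Addable ν))
  conormal ν = pluses (reduce (signature ℓ i ν))

  εᵢ : Partition → ℕ
  εᵢ ν = length (normal ν)

  φᵢ : Partition → ℕ
  φᵢ ν = length (conormal ν)

  -- The element 0 of the crystal is represented by nothing.
  ẽ : Partition → Maybe Partition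
  ẽ ν = Maybe.map (λ (_ , _ , μ , _) → μ) (head (normal ν))

  f̃ : Partition → Maybe Partition
  f̃ ν = Maybe.map (λ (_ , _ , μ , _) → μ) (last (conormal ν))

infixl 8 _^[_]_
_^[_]_ : (Partition → Maybe Partition) → ℕ → Partition → Maybe Partition
g ^[ zero  ] ν = just ν
g ^[ suc k ] ν = g ^[ k ] ν >>= g

{-# OPTIONS --safe #-}
-- Read a partition as the set of its beads row a - a; removing an ℓ-rim hook moves a bead
-- down by ℓ to a vacancy, and the hook is horizontal when no bead is jumped over. If some
-- column of λ has hook lengths both divisible and not divisible by ℓ, i.e. a vacancy v with
-- beads β ≡ v and γ ≢ v (mod ℓ), v < γ < β, then lowering the runner of v by horizontal hooks
-- eventually forces a bead to jump over γ, so λ is not an ℓ-partition.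
-- For an ℓ-partition this puts every removable i-box strictly above every addable i-box:
-- nothing cancels in the i-signature, and f̃ and ẽ only turn the last + into a - or the first
-- - into a +. In both parts the k-th image therefore still has two addable i-boxes, x below y,
-- and a removable i-box above them; the vacancy just after the bead of x, with the beads
-- of y and of the removable box, is again a column of mixed type.
module Submission where

open import Defs
open import Data.Empty using (⊥)
open import Data.Integer.Base as ℤ using () renaming (+_ to pos)
open import Data.Integer.DivMod using (_/ℕ_; a≡a%ℕn+[a/ℕn]*n)
import Data.Integer.Properties as ℤ
import Data.Integer.Tactic.RingSolver as ℤ-Solver
open import Data.List.Base
  using (List; []; _∷_; map; mapMaybe; length; head; last; cartesianProduct)
open import Data.List.Membership.Propositional using (_∉_) renaming (_∈_ to _∈ˡ_)
open import Data.List.Membership.Propositional.Properties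
  using (∈-cartesianProduct⁺; ∈-upTo⁺; ∈-downFrom⁺; ∈-map⁺; ∈-map⁻)
open import Data.List.Membership.Propositional.Properties.WithK using (unique∧set⇒bag)
open import Data.List.Properties using (length-map)
open import Data.List.Relation.Binary.BagAndSetEquality using (∼bag⇒↭)
open import Data.List.Relation.Binary.Permutation.Propositional.Properties using (↭-length)
open import Data.List.Relation.Unary.All as All using (All; []; _∷_)
import Data.List.Relation.Unary.All.Properties as All
open import Data.List.Relation.Unary.AllPairs as AllPairs using (AllPairs; []; _∷_)
import Data.List.Relation.Unary.AllPairs.Properties as AllPairs
open import Data.List.Relation.Unary.Any using (here; there)
open import Data.List.Relation.Unary.Linked using (Linked; [-]; _∷_)
open import Data.List.Relation.Unary.Unique.Propositional using (Unique)
open import Data.Maybe.Base as Maybe using (Maybe; just; nothing; _>>=_)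
open import Data.Maybe.Relation.Unary.Any using (Any; just)
open import Data.Nat.Base
open import Data.Nat.Divisibility using (divides; ∣m+n∣m⇒∣n; ∣1⇒≡1)
open import Data.Nat.Properties
open import Data.Nat.Tactic.RingSolver using (solve-∀)
open import Data.Product using (Σ; ∃; _×_; _,_; proj₁; proj₂)
open import Data.Product.Properties using (≡-dec)
open import Data.Sum.Base using (_⊎_; inj₁; inj₂)
open import Data.Unit.Base using (tt)
open import Function.Base using (id; _on_)
open import Function.Bundles using (_⇔_; mk⇔; Equivalence)
open import Relation.Binary.Construct.Closure.ReflexiveTransitive using (Star; ε; _◅_)
open import Relation.Binary.Definitions using (Tri; tri<; tri≈; tri>)
open import Relation.Binary.PropositionalEquality
open import Relation.Nullary using (¬_; Dec; yes; no; contradiction)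
open import Relation.Nullary.Decidable using (map′)

open Equivalence using (to; from)

-- Rim hooks and beads

antitone : ∀ {F : ℕ → ℕ} {r} → (∀ j → r ≤ j → F (suc j) ≤ F j) → ∀ d → F (d + r) ≤ F r
antitone dec zero    = ≤-refl
antitone {F} {r} dec (suc d) = ≤-trans (dec (d + r) (m≤n+m r d)) (antitone dec d)

-- A rim path of 1 + n boxes starting in (r , c), the last box of row r of the
-- diagram with row lengths F.
record Strip (F : ℕ → ℕ) (n r c : ℕ) : Set where
  field
    tail     : List Box
  path : List Box
  path = (r , c) ∷ tail
  field
    tail-size : length tail ≡ n
    linked    : Linked Adjacent path
    unique    : Unique path
    within    : All (λ x → proj₂ x < F (proj₁ x)) path
    lower     : All (λ x → r ≤ proj₁ x) path
    no-diag   : ∀ a b → ¬ ((a , b) ∈ˡ path × (suc a , suc b) ∈ˡ path)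
    remains   : ℕ → ℕ
    dec       : ∀ j → remains (suc j) ≤ remains j
    removes   : ∀ a b → b < remains a ⇔ (b < F a × (a , b) ∉ path)

open Strip

Straight : ∀ {F n r c} → Strip F n r c → Set
Straight {F} {n} {r} s = All (λ x → proj₁ x ≡ r) (path s) ×
  (∀ {j} → j ≢ r → remains s j ≡ F j) × remains s r + suc n ≡ F r

Bent : ∀ {F n r c} → Strip F n r c → Set
Bent {r = r} s = ∃ λ x → x ∈ˡ path s × proj₁ x ≢ r

shrink : ∀ {F r c} → F r ≡ suc c → ∀ a b →
         b < update F r c a ⇔ (b < F a × (a , b) ≢ (r , c))
shrink {F} {r} {c} eq a b with a ≟ r
... | no a≢r   = mk⇔ (λ p → p , λ { refl → a≢r refl }) proj₁
... | yes refl = mk⇔ (λ p → ≤-trans (m≤n⇒m≤1+n p) (≤-reflexive (sym eq)) , λ { refl → <-irrefl refl p })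
                     (λ (p , q) → ≤∧≢⇒< (≤-pred (≤-trans p (≤-reflexive eq))) (λ { refl → q refl }))

single : ∀ {F r c} → F r ≡ suc c → (∀ j → update F r c (suc j) ≤ update F r c j) → Strip F 0 r c
single {F} {r} {c} eq d = record
  { tail      = []
  ; tail-size = refl
  ; linked    = [-]
  ; unique    = [] ∷ []
  ; within    = ≤-reflexive (sym eq) ∷ []
  ; lower     = ≤-refl ∷ []
  ; no-diag   = λ { a b (here refl , here ()) }
  ; remains   = update F r c
  ; dec       = d
  ; removes   = λ a b → mk⇔
      (λ p → let (q , ne) = to (shrink {F} eq a b) p in q , λ { (here e) → ne e })
      (λ (q , ne) → from (shrink {F} eq a b) (q , λ e → ne (here e)))
  }

-- The strip `s` lies in the diagram with `(r , c)` already deleted, so it avoids that box. A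
-- diagonal pair with `(r , c)` is impossible: `below` keeps `(suc r , suc c)` outside the diagram,
-- and `s` has no box above row `r`.
extend : ∀ {F n r c r′ c′} → F r ≡ suc c → F (suc r) ≤ suc c → r ≤ r′ → Adjacent (r , c) (r′ , c′) →
         Strip (update F r c) n r′ c′ → Strip F (suc n) r c
extend {F} {r = r} {c} eq below r≤r′ adj s = record
  { tail      = path s
  ; tail-size = cong suc (tail-size s)
  ; linked    = adj ∷ linked s
  ; unique    = All.map (λ { p refl → <-irrefl (sym (update-≡ F r c)) p }) (within s) ∷ unique s
  ; within    = ≤-reflexive (sym eq) ∷ All.map (λ {x} p → proj₁ (to (shrink {F} eq _ _) p)) (within s)
  ; lower     = ≤-refl ∷ All.map (≤-trans r≤r′) (lower s)
  ; no-diag   = diag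
  ; remains   = remains s
  ; dec       = dec s
  ; removes   = λ a b → mk⇔
      (λ p → let (q , ∉s) = to (removes s a b) p
                 (q′ , ne) = to (shrink {F} eq a b) q
             in q′ , λ { (here e) → ne e ; (there m) → ∉s m })
      (λ (q , ∉p) → from (removes s a b)
         (from (shrink {F} eq a b) (q , λ e → ∉p (here e)) , λ m → ∉p (there m)))
  }
  where
  diag : ∀ a b → ¬ ((a , b) ∈ˡ (r , c) ∷ path s × (suc a , suc b) ∈ˡ (r , c) ∷ path s)
  diag a b (here refl , here ())
  diag a b (here refl , there q) =
    <⇒≱ (proj₁ (to (shrink {F} eq _ _) (All.lookup (within s) q))) below
  diag a b (there p , here refl) = <-irrefl refl (≤-trans r≤r′ (All.lookup (lower s) p))
  diag a b (there p , there q) = no-diag s a b (p , q)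

-- The path turns down whenever the box below belongs to F. Since t, the content shifted by N
-- of its last box, is not a bead, it neither leaves the diagram nor ends where it has
-- to turn down, so that removing it leaves a partition.
strip : ∀ n F r c N t →
        F r ≡ suc c →
        -- Row `r` may be one box longer than the row above, namely when the path has just come down
        -- from there.
        (∀ j → suc j ≢ r → F (suc j) ≤ F j) →
        (∀ j → suc j ≡ r → c ≤ F j) →
        t + suc n + r ≡ suc c + N →
        (∀ j → r < j → F j + N ≢ t + j) →
        Σ (Strip F n r c) λ s → Bent s ⊎ Straight s
strip n F r c N t eq d up start vacant with c <? F (suc r)
-- With no further box to turn down into, row `suc r` would have length `suc c`, which places its
-- bead exactly at `t`.
strip zero F r c N t eq d up start vacant | yes c< = contradiction hit (vacant (suc r) (n<1+n r))
  where
  hit : F (suc r) + N ≡ t + suc r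
  hit = trans (cong (_+ N) (≤-antisym (≤-trans (d r 1+n≢n) (≤-reflexive eq)) c<))
              (trans (sym start) (+-assoc t 1 r))
strip (suc n) F r c N t eq d up start vacant | yes c< =
  extend eq below (n≤1+n r) adj s , inj₁ ((suc r , c) , there (here refl) , 1+n≢n)
  where
  below : F (suc r) ≤ suc c
  below = ≤-trans (d r 1+n≢n) (≤-reflexive eq)
  adj : Adjacent (r , c) (suc r , c)
  adj = cong₂ _+_ (trans (∣-∣-comm r (suc r)) (trans (cong (∣_- r ∣) (+-comm 1 r)) (∣m+n-m∣ r 1))) (∣n-n∣≡0 c)
    where
    ∣m+n-m∣ : ∀ m n → ∣ m + n - m ∣ ≡ n
    ∣m+n-m∣ m n = trans (∣-∣-comm (m + n) m) (∣m-m+n∣≡n m n)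
  F′ : ℕ → ℕ
  F′ = update F r c
  same : ∀ {j} → j ≢ r → F′ j ≡ F j
  same = update-≢ F r c
  d′ : ∀ j → suc j ≢ suc r → F′ (suc j) ≤ F′ j
  d′ j ne with suc j ≟ r | j ≟ r
  ... | _      | yes refl = contradiction refl ne
  ... | yes e  | no _     = up j e
  ... | no ne′ | no _     = d j ne′
  up′ : ∀ j → suc j ≡ suc r → c ≤ F′ j
  up′ j refl = ≤-reflexive (sym (update-≡ F r c))
  s = proj₁ (strip n F′ (suc r) c N t
        (trans (same 1+n≢n) (≤-antisym below c<)) d′ up′
        (trans (shift t n r) start)
        (λ j r<j p → vacant j (<-trans (n<1+n r) r<j)
           (trans (cong (_+ N) (sym (same (λ { refl → <-irrefl refl (<-trans (n<1+n j) r<j) })))) p)))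
    where
    shift : ∀ t n r → t + suc n + suc r ≡ t + suc (suc n) + r
    shift = solve-∀
strip n F r c N t eq d up start vacant | no c≮ = step n c eq up start (≮⇒≥ c≮)
  where
  dec′ : ∀ {c} → F r ≡ suc c → (∀ j → suc j ≡ r → c ≤ F j) → F (suc r) ≤ c →
         ∀ j → update F r c (suc j) ≤ update F r c j
  dec′ eq up below j with suc j ≟ r | j ≟ r
  ... | yes e | yes refl = contradiction e 1+n≢n
  ... | yes e | no _     = up j e
  ... | no _  | yes refl = below
  ... | no ne | no _     = d j ne
  step : ∀ n c → F r ≡ suc c → (∀ j → suc j ≡ r → c ≤ F j) → t + suc n + r ≡ suc c + N →
         F (suc r) ≤ c → Σ (Strip F n r c) λ s → Bent s ⊎ Straight s
  step zero c eq up start below =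
    single eq (dec′ eq up below) ,
    inj₂ (refl ∷ [] , update-≢ F r c ,
          trans (cong (_+ 1) (update-≡ F r c)) (trans (+-comm c 1) (sym eq)))
  -- In the first column with boxes still to be taken, row `n + suc r` is empty and its bead is `t`.
  step (suc n) zero eq up start below =
    contradiction (trans (cong (_+ N) zeros) (suc-injective (trans (sym start) (shuffle t n r))))
                  (vacant (n + suc r) (m≤n+m (suc r) n))
    where
    shuffle : ∀ t n r → t + suc (suc n) + r ≡ suc (t + (n + suc r))
    shuffle = solve-∀
    zeros : F (n + suc r) ≡ 0
    zeros = n≤0⇒n≡0 (≤-trans (antitone (λ j r<j → d j (λ { refl → <-asym r<j (n<1+n j) })) n) below)
  step (suc n) (suc c) eq up start below =
    let (s , shape) = rec in
    extend eq (m≤n⇒m≤1+n below) ≤-refl adj s , widen s shape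
    where
    F′ : ℕ → ℕ
    F′ = update F r (suc c)
    adj : Adjacent (r , suc c) (r , c)
    adj = trans (cong (_+ ∣ suc c - c ∣) (∣n-n∣≡0 r))
            (trans (∣-∣-comm (suc c) c) (trans (cong (∣ c -_∣) (+-comm 1 c)) (∣m-m+n∣≡n c 1)))
    rec : Σ (Strip F′ n r c) λ s → Bent s ⊎ Straight s
    rec = strip n F′ r c N t (update-≡ F r (suc c))
      (λ j _ → dec′ eq up below j)
      (λ { j refl → ≤-trans (n≤1+n c) (≤-trans (up j refl)
             (≤-reflexive (sym (update-≢ F (suc j) (suc c) (≢-sym 1+n≢n))))) })
      (suc-injective (trans (shift t n r) start))
      (λ j r<j p → vacant j r<j
         (trans (cong (_+ N) (sym (update-≢ F r (suc c) (λ { refl → <-irrefl refl r<j })))) p))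
      where
      shift : ∀ t n r → suc (t + suc n + r) ≡ t + suc (suc n) + r
      shift = solve-∀
    widen : ∀ s → Bent s ⊎ Straight s →
            let s′ = extend eq (m≤n⇒m≤1+n below) ≤-refl adj s in Bent s′ ⊎ Straight s′
    widen s (inj₁ (x , x∈ , ne)) = inj₁ (x , there x∈ , ne)
    widen s (inj₂ (flat , same , len)) =
      inj₂ (refl ∷ flat , (λ ne → trans (same ne) (update-≢ F r (suc c) ne)) ,
            trans (+-suc (remains s r) (suc n))
              (trans (cong suc (trans len (update-≡ F r (suc c)))) (sym eq)))

-- All beads are shifted by N.
Vacant : Partition → ℕ → ℕ → Set
Vacant ν N v = ∀ j → row ν j + N ≢ v + j

row-anti : ∀ ν {a b} → a ≤ b → row ν b ≤ row ν a
row-anti ν {a} {b} a≤b =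
  subst (λ b → row ν b ≤ row ν a) (m∸n+n≡m a≤b) (antitone (λ j _ → row-dec ν j) (b ∸ a))

row-end : ∀ ν → row ν (length (parts ν)) ≡ 0
row-end ν = trans (cong (row ν) (sym (+-identityʳ _))) (rowLength-end (parts ν) 0)

-- The equation `row ν a + N ≡ x + a` says that the bead of row `a` sits at `x`. A strip of `ℓ`
-- boxes from the end of row `a` can be removed because `t` is vacant; if it never turns down, the
-- bead simply moves to `t`.
moveBead : ∀ {ℓ} ν N a t → 0 < ℓ → row ν a + N ≡ t + ℓ + a → Vacant ν N t →
  Σ (RimHook ℓ ν) λ h → ¬ Horizontal h ⊎
    (Horizontal h × (∀ {j} → j ≢ a → row (rest h) j ≡ row ν j) × row (rest h) a + ℓ ≡ row ν a)
moveBead {suc n} ν N a t _ start vac = build (row ν a) refl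
  where
  build : ∀ m → row ν a ≡ m → Σ (RimHook (suc n) ν) λ h → ¬ Horizontal h ⊎
    (Horizontal h × (∀ {j} → j ≢ a → row (rest h) j ≡ row ν j) × row (rest h) a + suc n ≡ row ν a)
  -- If row `a` were empty, row `suc n + a` would be empty too, with its bead `ℓ` lower, at `t`.
  build zero eq = contradiction
    (trans (cong (_+ N) (trans (n≤0⇒n≡0 (≤-trans (row-anti ν (m≤n+m a (suc n))) (≤-reflexive eq))) (sym eq)))
           (trans start (+-assoc t (suc n) a)))
    (vac (suc n + a))
  build (suc c) eq with strip n (row ν) a c N t eq (λ j _ → row-dec ν j)
      (λ { j refl → ≤-trans (n≤1+n c) (≤-trans (≤-reflexive (sym eq)) (row-dec ν j)) })
      (trans (sym start) (cong (_+ N) eq)) (λ j _ → vac j)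
  ... | s , shape = hook , classify shape
    where
    lower-rows : ∀ b → remains s b ≤ row ν b
    lower-rows b = ≮⇒≥ λ p → <-irrefl refl (proj₁ (to (removes s b (row ν b)) p))
    ρ = fromRows (remains s) (dec s) (length (parts ν))
          (n≤0⇒n≡0 (≤-trans (lower-rows _) (≤-reflexive (row-end ν))))
    hook : RimHook (suc n) ν
    hook = record
      { boxes     = path s
      ; size      = cong suc (tail-size s)
      ; distinct  = unique s
      ; connected = linked s
      ; inside    = within s
      ; no-2×2    = λ a b (p , _ , _ , q) → no-diag s a b (p , q)
      ; rest      = proj₁ ρ
      ; removed   = λ (a , b) → mk⇔
          (λ p → to (removes s a b) (≤-trans p (≤-reflexive (proj₂ ρ a))))
          (λ p → ≤-trans (from (removes s a b) p) (≤-reflexive (sym (proj₂ ρ a))))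
      }
    classify : Bent s ⊎ Straight s → ¬ Horizontal hook ⊎
      (Horizontal hook × (∀ {j} → j ≢ a → row (rest hook) j ≡ row ν j) × row (rest hook) a + suc n ≡ row ν a)
    classify (inj₁ (x , x∈ , ne)) = inj₁ λ { (b , flat@(a≡b ∷ _)) →
      ne (trans (All.lookup flat x∈) (sym a≡b)) }
    classify (inj₂ (flat , same , len)) = inj₂
      ((a , flat) , (λ {j} ne → trans (proj₂ ρ j) (same ne)) , trans (cong (_+ suc n) (proj₂ ρ a)) len)

-- Beads strictly decrease from row to row, as row lengths fall weakly while indices rise.
bead-injective : ∀ ν {N x a b} → row ν a + N ≡ x + a → row ν b + N ≡ x + b → a ≡ b
bead-injective ν {N} {x} p q = ≤-antisym (le p q) (le q p)
  where
  le : ∀ {a b} → row ν a + N ≡ x + a → row ν b + N ≡ x + b → a ≤ b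
  le {a} {b} p q = ≮⇒≥ λ b<a → <-irrefl refl
    (≤-trans (+-monoʳ-< x b<a)
      (≤-trans (≤-reflexive (sym p)) (≤-trans (+-monoˡ-≤ N (row-anti ν (<⇒≤ b<a))) (≤-reflexive q))))

-- Positions are natural numbers, so a row with bead `x` has index at most `row ν 0 + N` and a
-- bounded search decides.
bead? : ∀ ν N x → Dec (∃ λ a → row ν a + N ≡ x + a)
bead? ν N x = map′ (λ (a , _ , p) → a , p)
  (λ (a , p) → a , s≤s (≤-trans (m≤n+m a x) (≤-trans (≤-reflexive (sym p)) (+-monoˡ-≤ N (row-anti ν z≤n)))) , p)
  (anyUpTo? (λ a → row ν a + N ≟ x + a) (suc (row ν 0 + N)))

-- Crossings and the lowering of a runner

HookFree : ℕ → Partition → Set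
HookFree ℓ ν = ∀ μ → Star (RemoveHorizontalHook ℓ) ν μ → NoNonHorizontalHook ℓ μ

module _ {ℓ : ℕ} (0<ℓ : 0 < ℓ) (N : ℕ) where

  -- In the column of the vacancy v, the hook length in row q is divisible by ℓ and
  -- the one in row p is not; row s holds a further bead of the runner of v.
  record Crossing (ν : Partition) (v k j : ℕ) : Set where
    field
      p q s : ℕ
      free  : HookFree ℓ ν
      vac   : Vacant ν N v
      above : v + p < row ν p + N
      off   : ∀ m → row ν p + N ≢ v + m * ℓ + p
      q<p   : q < p
      on-q  : row ν q + N ≡ v + k * ℓ + q
      on-s  : row ν s + N ≡ v + j * ℓ + s

  -- The beads on the runner of v are lowered by horizontal hooks, starting with those
  -- below row p, until one of them has to jump over the bead in row p.
  lower-runner : ∀ K → (∀ {ν v k j} → k ≤ K → j ≤ K → ¬ Crossing ν v k j) →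
                 ∀ j {ν v k} → k ≤ suc K → j ≤ suc K → ¬ Crossing ν v k j
  lower-runner K ih zero {v = v} _ _ C = vac s (trans on-s (cong (_+ s) (+-identityʳ v)))
    where open Crossing C
  lower-runner K ih (suc j) {v = v} {zero} _ _ C = vac q (trans on-q (cong (_+ q) (+-identityʳ v)))
    where open Crossing C
  lower-runner K ih (suc j) {ν} {v} {suc k} k≤K j≤K C with bead? ν N (v + j * ℓ)
  ... | yes (s′ , on-s′) =
    -- Any bead of the runner may play the role of `s`; the one at `v + j * ℓ` lowers `j`.
    lower-runner K ih j k≤K (m≤n⇒m≤1+n (≤-pred j≤K))
      record { Crossing C hiding (s; on-s) ; s = s′ ; on-s = on-s′ }
  ... | no empty
    -- Now `v + j * ℓ` is empty and the bead of row `s` can be lowered; a non-horizontal hook is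
    -- excluded at once, a horizontal one leads from `ν` to `μ`.
    with moveBead ν N (Crossing.s C) (v + j * ℓ) 0<ℓ
           (trans (Crossing.on-s C) (cong (_+ Crossing.s C) (shift v j ℓ))) (λ a e → empty (a , e))
    where
    shift : ∀ v j ℓ → v + suc j * ℓ ≡ v + j * ℓ + ℓ
    shift = solve-∀
  ...   | h , inj₁ bent = Crossing.free C ν ε (h , bent)
  ...   | h , inj₂ (flat , same , len) = split (<-cmp s p)
    where
    open Crossing C
    μ = rest h
    free′ : HookFree ℓ μ
    free′ κ st = free κ ((h , flat , refl) ◅ st)

    on-s′ : row μ s + N ≡ v + j * ℓ + s
    on-s′ = +-cancelʳ-≡ ℓ _ _ (trans (swap (row μ s) N ℓ) (trans (cong (_+ N) len) (trans on-s (move v j ℓ s))))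
      where
      swap : ∀ x N ℓ → x + N + ℓ ≡ x + ℓ + N
      swap = solve-∀
      move : ∀ v j ℓ s → v + suc j * ℓ + s ≡ v + j * ℓ + s + ℓ
      move = solve-∀

    -- Only the new bead in row s could fill the vacancy v.
    vac′ : 0 < j * ℓ → Vacant μ N v
    vac′ 0<jℓ a e with a ≟ s
    ... | no ne    = vac a (trans (cong (_+ N) (sym (same ne))) e)
    ... | yes refl = <-irrefl (trans (sym e) on-s′) (+-monoˡ-< s (m<m+n v 0<jℓ))

    split : Tri (s < p) (s ≡ p) (p < s) → ⊥
    split (tri≈ _ refl _) = off (suc j) on-s
    -- Lowering keeps the bead in row `s`, above row `p`, so it takes the place of the bead of row
    -- `q`, and both multipliers become `j`.
    split (tri< s<p _ _) =
      ih (≤-pred j≤K) (≤-pred j≤K) record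
        { p = p ; q = s ; s = s ; free = free′ ; vac = vac′ 0<jℓ
        ; above = ≤-trans above (≤-reflexive (sym same-p))
        ; off   = λ m e → off m (trans (sym same-p) e)
        ; q<p   = s<p ; on-q = on-s′ ; on-s = on-s′ }
      where
      same-p : row μ p + N ≡ row ν p + N
      same-p = cong (_+ N) (same (λ { refl → <-irrefl refl s<p }))
      0<jℓ : 0 < j * ℓ
      -- If `j * ℓ` were 0, the lowered bead would be at `v`, yet it exceeds the bead of row `p`,
      -- which exceeds `v`.
      0<jℓ = n≢0⇒n>0 λ z → <-irrefl refl (begin-strict
        v + p          <⟨ above ⟩
        row ν p + N    ≡⟨ same-p ⟨
        row μ p + N    ≤⟨ +-monoˡ-≤ N (row-anti μ (<⇒≤ s<p)) ⟩
        row μ s + N    ≡⟨ on-s′ ⟩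
        v + j * ℓ + s  ≡⟨ cong (λ x → v + x + s) z ⟩
        v + 0 + s      ≡⟨ cong (_+ s) (+-identityʳ v) ⟩
        v + s          <⟨ +-monoʳ-< v s<p ⟩
        v + p          ∎)
        where open ≤-Reasoning
    split (tri> _ _ p<s) = step j refl
      where
      same-p : row μ p + N ≡ row ν p + N
      same-p = cong (_+ N) (same (λ { refl → <-irrefl refl p<s }))
      same-q : row μ q + N ≡ row ν q + N
      same-q = cong (_+ N) (same (λ { refl → <-asym q<p p<s }))
      step : ∀ i → i ≡ j → ⊥
      -- The bead stops short of `v`, which stays vacant, and the lowering goes on.
      step (suc i) refl =
        lower-runner K ih j k≤K (m≤n⇒m≤1+n (≤-pred j≤K)) record
          { p = p ; q = q ; s = s ; free = free′ ; vac = vac′ (≤-trans 0<ℓ (m≤m+n ℓ (i * ℓ)))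
          ; above = ≤-trans above (≤-reflexive (sym same-p))
          ; off   = λ m e → off m (trans (sym same-p) e)
          ; q<p   = q<p ; on-q = trans same-q on-q ; on-s = on-s′ }
      -- The bead of row `s` has filled `v` and left `v + ℓ` empty. The bead of row `p` lay above
      -- it, hence above `v + ℓ`, so the crossing persists with vacancy `v + ℓ`, and the multiplier
      -- of row `q` drops to `k`.
      step zero refl =
        ih {v = v + ℓ} (≤-pred k≤K) (≤-pred k≤K) record
          { p = p ; q = q ; s = q ; free = free′ ; vac = vacant ; above = above′
          ; off = λ m e → off (suc m) (trans (sym same-p) (trans e (assoc v m ℓ p)))
          ; q<p = q<p ; on-q = on-q′ ; on-s = on-q′ }
        where
        assoc : ∀ v m ℓ p → v + ℓ + m * ℓ + p ≡ v + suc m * ℓ + p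
        assoc = solve-∀
        one : ∀ v ℓ s → v + 1 * ℓ + s ≡ v + ℓ + s
        one = solve-∀
        on-q′ : row μ q + N ≡ v + ℓ + k * ℓ + q
        on-q′ = trans same-q (trans on-q (sym (assoc v k ℓ q)))
        vacant : Vacant μ N (v + ℓ)
        vacant a e with a ≟ s
        ... | no ne    = ne (bead-injective ν (trans (cong (_+ N) (sym (same ne))) e) (trans on-s (one v ℓ s)))
        ... | yes refl = <-irrefl (trans (sym on-s′) e)
                           (+-monoˡ-< s (≤-<-trans (≤-reflexive (+-identityʳ v)) (m<m+n v 0<ℓ)))
        above′ : v + ℓ + p < row μ p + N
        above′ = begin-strict
          v + ℓ + p    <⟨ +-monoʳ-< (v + ℓ) p<s ⟩
          v + ℓ + s    ≡⟨ trans on-s (one v ℓ s) ⟨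
          row ν s + N  ≤⟨ +-monoˡ-≤ N (row-anti ν (<⇒≤ p<s)) ⟩
          row ν p + N  ≡⟨ same-p ⟨
          row μ p + N  ∎
          where open ≤-Reasoning

  -- Induction on a common bound for both multipliers: inside `lower-runner` either `j` drops or
  -- both fall to at most `K`. With `k = 0` the bead of row `q` would sit in the vacancy.
  no-crossing : ∀ K {ν v k j} → k ≤ K → j ≤ K → ¬ Crossing ν v k j
  no-crossing zero {v = v} z≤n _ C =
    Crossing.vac C _ (trans (Crossing.on-q C) (cong (_+ _) (+-identityʳ v)))
  no-crossing (suc K) {j = j} = lower-runner K (no-crossing K) j

-- Equal residues mean congruent contents; the inequality orders the contents, so their difference
-- is a natural multiple of `ℓ`. The form without subtraction matches the equations for beads.
residue-≡ : ∀ ℓ .{{_ : NonZero ℓ}} a b c d → residue ℓ (a , b) ≡ residue ℓ (c , d) →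
            b + c ≤ d + a → ∃ λ m → d + a ≡ b + m * ℓ + c
residue-≡ ℓ a b c d eq le = m , sym (trans (swap b (m * ℓ) c) (trans (cong (_+ (b + c)) (sym e≡)) (m∸n+n≡m le)))
  where
  open ≡-Reasoning
  e = d + a ∸ (b + c)
  x = pos b ℤ.- pos a
  y = pos d ℤ.- pos c
  q = (y /ℕ ℓ) ℤ.- (x /ℕ ℓ)
  m = ℤ.∣ q ∣
  r = pos (residue ℓ (a , b))
  swap : ∀ b n c → b + n + c ≡ n + (b + c)
  swap = solve-∀
  difference : ∀ e a b c d → e ℤ.+ (b ℤ.+ c) ≡ d ℤ.+ a → e ≡ (d ℤ.- c) ℤ.- (b ℤ.- a)
  difference e a b c d p = trans (ring₁ e b c) (trans (cong (ℤ._- (b ℤ.+ c)) p) (ring₂ a b c d))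
    where
    ring₁ : ∀ e b c → e ≡ e ℤ.+ (b ℤ.+ c) ℤ.- (b ℤ.+ c)
    ring₁ = ℤ-Solver.solve-∀
    ring₂ : ∀ a b c d → d ℤ.+ a ℤ.- (b ℤ.+ c) ≡ (d ℤ.- c) ℤ.- (b ℤ.- a)
    ring₂ = ℤ-Solver.solve-∀
  quotients : ∀ r s t n → (r ℤ.+ s ℤ.* n) ℤ.- (r ℤ.+ t ℤ.* n) ≡ (s ℤ.- t) ℤ.* n
  quotients = ℤ-Solver.solve-∀
  y≡ : y ≡ r ℤ.+ (y /ℕ ℓ) ℤ.* pos ℓ
  y≡ = trans (a≡a%ℕn+[a/ℕn]*n y ℓ) (cong (λ r → pos r ℤ.+ (y /ℕ ℓ) ℤ.* pos ℓ) (sym eq))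
  e≡ : e ≡ m * ℓ
  -- Taking absolute values of `pos e ≡ q * pos ℓ` avoids determining the sign of `q`.
  e≡ = trans (cong ℤ.∣_∣ (begin
    pos e
      ≡⟨ difference (pos e) (pos a) (pos b) (pos c) (pos d) (cong pos (m∸n+n≡m le)) ⟩
    y ℤ.- x
      ≡⟨ cong₂ ℤ._-_ y≡ (a≡a%ℕn+[a/ℕn]*n x ℓ) ⟩
    (r ℤ.+ (y /ℕ ℓ) ℤ.* pos ℓ) ℤ.- (r ℤ.+ (x /ℕ ℓ) ℤ.* pos ℓ)
      ≡⟨ quotients r (y /ℕ ℓ) (x /ℕ ℓ) (pos ℓ) ⟩
    q ℤ.* pos ℓ ∎)) (ℤ.abs-* q (pos ℓ))

-- Lists

_≟ᵇ_ : (x y : Box) → Dec (x ≡ y)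
_≟ᵇ_ = ≡-dec _≟_ _≟_

∈-mapMaybe⁻ : ∀ {A B : Set} (f : A → Maybe B) xs {y} → y ∈ˡ mapMaybe f xs → ∃ λ x → x ∈ˡ xs × f x ≡ just y
∈-mapMaybe⁻ f (x ∷ xs) y∈ with f x in eq | y∈
... | nothing | p         = let (z , z∈ , e) = ∈-mapMaybe⁻ f xs p in z , there z∈ , e
... | just _  | here refl = x , here refl , eq
... | just _  | there p   = let (z , z∈ , e) = ∈-mapMaybe⁻ f xs p in z , there z∈ , e

∈-mapMaybe⁺ : ∀ {A B : Set} (f : A → Maybe B) {xs x y} → x ∈ˡ xs → f x ≡ just y → y ∈ˡ mapMaybe f xs
∈-mapMaybe⁺ f {x ∷ xs} (here refl) eq with f x | eq
... | just _  | refl = here refl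
∈-mapMaybe⁺ f {x ∷ xs} (there x∈) eq with f x
... | nothing = ∈-mapMaybe⁺ f x∈ eq
... | just _  = there (∈-mapMaybe⁺ f x∈ eq)

mapMaybe-AllPairs : ∀ {A B : Set} {R : A → A → Set} (f : A → Maybe B) (g : B → A) →
  (∀ {x y} → f x ≡ just y → g y ≡ x) → ∀ {xs} → AllPairs R xs → AllPairs (R on g) (mapMaybe f xs)
mapMaybe-AllPairs f g inv []                 = []
mapMaybe-AllPairs {R = R} f g inv {x ∷ xs} (px ∷ pxs) with f x in eq
... | nothing = mapMaybe-AllPairs f g inv pxs
... | just y  =
  All.tabulate (λ z∈ → let (w , w∈ , e) = ∈-mapMaybe⁻ f xs z∈ in
    subst₂ R (sym (inv eq)) (sym (inv e)) (All.lookup px w∈)) ∷ mapMaybe-AllPairs f g inv pxs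

-- Duplicate-free lists with the same members are permutations of each other.
unique-length : ∀ {A : Set} {xs ys : List A} → Unique xs → Unique ys → (∀ z → z ∈ˡ xs ⇔ z ∈ˡ ys) →
                length xs ≡ length ys
unique-length ux uy eq = ↭-length (∼bag⇒↭ (unique∧set⇒bag ux uy (λ {z} → eq z)))

head-first : ∀ {A : Set} {R : A → A → Set} {xs : List A} {x} → AllPairs R xs → head xs ≡ just x →
             x ∈ˡ xs × (∀ {z} → z ∈ˡ xs → z ≡ x ⊎ R x z)
head-first (px ∷ _) refl = here refl , λ { (here e) → inj₁ e ; (there z∈) → inj₂ (All.lookup px z∈) }

head-map : ∀ {A B : Set} (f : A → B) {xs x} → head xs ≡ just x → head (map f xs) ≡ just (f x)
head-map f {_ ∷ _} refl = refl

last-map : ∀ {A B : Set} (f : A → B) {xs x} → last xs ≡ just x → last (map f xs) ≡ just (f x)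
last-map f {_ ∷ []}         refl = refl
last-map f {_ ∷ xs@(_ ∷ _)} eq   = last-map f {xs} eq

last-final : ∀ {A : Set} {R : A → A → Set} {xs : List A} {x} → AllPairs R xs → last xs ≡ just x →
             x ∈ˡ xs × (∀ {z} → z ∈ˡ xs → z ≡ x ⊎ R z x)
last-final {xs = _ ∷ []} _ refl = here refl , λ { (here e) → inj₁ e }
last-final {xs = _ ∷ _ ∷ _} (px ∷ pxs) eq =
  let (x∈ , below) = last-final pxs eq in
  there x∈ , λ { (here refl) → inj₂ (All.lookup px x∈) ; (there z∈) → below z∈ }

map-just⁻ : ∀ {A B : Set} {f : A → B} m {y} → Maybe.map f m ≡ just y → ∃ λ x → m ≡ just x × f x ≡ y
map-just⁻ (just x) refl = x , refl , refl

>>=-just⁻ : ∀ {A B : Set} (m : Maybe A) {f : A → Maybe B} {y} → (m >>= f) ≡ just y →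
            ∃ λ x → m ≡ just x × f x ≡ just y
>>=-just⁻ (just x) eq = x , refl , eq

Any-just⁻ : ∀ {A : Set} {P : A → Set} {m : Maybe A} → Any P m → ∃ λ x → m ≡ just x × P x
Any-just⁻ (just p) = _ , refl , p

same-length : ∀ {m n} → (∀ d → d < m ⇔ d < n) → m ≡ n
same-length eq = ≤-antisym (≮⇒≥ λ p → <-irrefl refl (to (eq _) p)) (≮⇒≥ λ p → <-irrefl refl (from (eq _) p))

-- Signatures

-- The order in which positions lists the boxes.
_≺_ : Box → Box → Set
(a , b) ≺ (c , d) = c < a ⊎ (a ≡ c × b < d)

≺⇒≢ : ∀ {x y} → x ≺ y → x ≢ y
≺⇒≢ (inj₁ p)       refl = <-irrefl refl p
≺⇒≢ (inj₂ (_ , p)) refl = <-irrefl refl p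

≺⇒≥ : ∀ {x y} → x ≺ y → proj₁ y ≤ proj₁ x
≺⇒≥ (inj₁ p)          = <⇒≤ p
≺⇒≥ (inj₂ (refl , _)) = ≤-refl

positions-sorted : ∀ ν → AllPairs _≺_ (positions ν)
positions-sorted ν = product (AllPairs.applyDownFrom⁺₁ id (suc (length (parts ν))) λ p _ → p)
                             (AllPairs.applyUpTo⁺₁ id (suc (row ν 0)) λ p _ → p)
  where
  product : ∀ {as bs} → AllPairs _>_ as → AllPairs _<_ bs → AllPairs _≺_ (cartesianProduct as bs)
  product []         _  = []
  product {a ∷ as} {bs} (p ∷ ps) qs = AllPairs.++⁺
    (AllPairs.map⁺ (AllPairs.map (λ q → inj₂ (refl , q)) qs)) (product ps qs)
    (All.map⁺ (All.universal (λ _ → All.cartesianProduct⁺ (setoid ℕ) (setoid ℕ) as bs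
      λ c∈ _ → inj₁ (All.lookup p c∈)) bs))

row-pos : ∀ ν {a b} → b < row ν a → a < length (parts ν)
row-pos ν {a} p = ≰⇒> λ le → n≮0 (≤-trans p (≤-trans (row-anti ν le) (≤-reflexive (row-end ν))))

∈-positions : ∀ ν {a b} → a ≤ length (parts ν) → b ≤ row ν 0 → (a , b) ∈ˡ positions ν
∈-positions ν p q = ∈-cartesianProduct⁺ (∈-downFrom⁺ (s≤s p)) (∈-upTo⁺ (s≤s q))

addable-position : ∀ ν {x} → Addable ν x → x ∈ˡ positions ν
addable-position ν {a , b} ad with addable⇒corner ν _ ad
... | eq , longer = ∈-positions ν (height a longer) (≤-trans (≤-reflexive (sym eq)) (row-anti ν z≤n))
  where
  height : ∀ a → LongerAbove ν a b → a ≤ length (parts ν)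
  height zero    _ = z≤n
  height (suc c) p = row-pos ν p

removable-position : ∀ ν {x} → Removable ν x → x ∈ˡ positions ν
removable-position ν (p , _) = ∈-positions ν (<⇒≤ (row-pos ν p)) (<⇒≤ (≤-trans p (row-anti ν z≤n)))

-- One relation in terms of row lengths serves both operators: `f̃` passes from `ν` to `μ`, `ẽ` from
-- `μ` to `ν`.
record Grows (ν μ : Partition) (y : Box) : Set where
  field
    old  : row ν (proj₁ y) ≡ proj₂ y
    new  : row μ (proj₁ y) ≡ suc (proj₂ y)
    same : ∀ {c} → c ≢ proj₁ y → row μ c ≡ row ν c

addable⇒grows : ∀ ν {y} (ad : Addable ν y) → Grows ν (proj₁ (proj₂ ad)) y
addable⇒grows ν {a , b} ad@(_ , μ , e) = record
  { old  = old
  ; new  = same-length λ d → mk⇔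
      (λ p → within-new (to (e (a , d)) p))
      (λ p → from (e (a , d)) (in-old-or-new (d ≟ b) p))
  ; same = λ {c} c≢a → same-length λ d → mk⇔
      (λ p → in-old c≢a (to (e (c , d)) p))
      (λ p → from (e (c , d)) (inj₁ p))
  }
  where
  old = proj₁ (addable⇒corner ν _ ad)
  within-new : ∀ {d} → d < row ν a ⊎ (a , d) ≡ (a , b) → d < suc b
  within-new (inj₁ p)    = m≤n⇒m≤1+n (≤-trans p (≤-reflexive old))
  within-new (inj₂ refl) = ≤-refl
  in-old-or-new : ∀ {d} → Dec (d ≡ b) → d < suc b → d < row ν a ⊎ (a , d) ≡ (a , b)
  in-old-or-new (yes refl) _ = inj₂ refl
  in-old-or-new (no d≢b)   p = inj₁ (≤-trans (≤∧≢⇒< (≤-pred p) d≢b) (≤-reflexive (sym old)))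
  in-old : ∀ {c d} → c ≢ a → d < row ν c ⊎ (c , d) ≡ (a , b) → d < row ν c
  in-old _   (inj₁ p)    = p
  in-old c≢a (inj₂ refl) = contradiction refl c≢a

removable⇒grows : ∀ μ {y} (rm : Removable μ y) → Grows (proj₁ (proj₂ rm)) μ y
removable⇒grows μ {a , b} rm@(_ , ν , e) = record
  { old  = same-length λ d → mk⇔
      (λ p → let (q , ne) = to (e (a , d)) p in
        ≤∧≢⇒< (≤-pred (≤-trans q (≤-reflexive new))) λ { refl → ne refl })
      (λ p → from (e (a , d)) (≤-trans (m≤n⇒m≤1+n p) (≤-reflexive (sym new)) , λ { refl → <-irrefl refl p }))
  ; new  = new
  ; same = λ {c} c≢a → sym (same-length λ d → mk⇔
      (λ p → proj₁ (to (e (c , d)) p))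
      (λ p → from (e (c , d)) (p , λ { refl → c≢a refl })))
  }
  where
  new = proj₁ (removable⇒corner μ _ rm)

module _ {ν μ : Partition} {y : Box} (g : Grows ν μ y) where
  open Grows g

  grows⇒addable : Addable ν y
  grows⇒addable = corner⇒addable ν y (old , above (proj₁ y) refl)
    where
    above : ∀ a → a ≡ proj₁ y → LongerAbove ν a (proj₂ y)
    above zero    _    = tt
    above (suc c) refl =
      subst (_≤ row ν c) new (≤-trans (row-dec μ c) (≤-reflexive (same (≢-sym 1+n≢n))))

  grows⇒removable : Removable μ y
  grows⇒removable = corner⇒removable μ y
    (new , ≤-trans (≤-reflexive (same 1+n≢n)) (≤-trans (row-dec ν (proj₁ y)) (≤-reflexive old)))

  grown-not-addable : ¬ Addable μ y
  grown-not-addable (y∉ , _) = y∉ (≤-reflexive (sym new))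

  ungrown-not-removable : ¬ Removable ν y
  ungrown-not-removable (y∈ , _) = <-irrefl (sym old) y∈

-- Signs of `i`-boxes and the crystal operators

module Crystal (ℓ : ℕ) .{{_ : NonZero ℓ}} (2≤ℓ : 2 ≤ ℓ) (i : ℕ) where

  no-unit : ∀ m → 1 ≢ m * ℓ
  no-unit m eq = <-irrefl (sym (m*n≡1⇒n≡1 m ℓ (sym eq))) 2≤ℓ

  -- Contents of neighbouring boxes differ by 1, no multiple of `ℓ` since `2 ≤ ℓ`.
  right-neighbour : ∀ a b → residue ℓ (a , b) ≢ residue ℓ (a , suc b)
  right-neighbour a b eq with residue-≡ ℓ a b a (suc b) eq (n≤1+n (b + a))
  ... | m , e = no-unit m (+-cancelˡ-≡ b _ _ (trans (+-comm b 1) (+-cancelʳ-≡ a _ _ e)))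

  lower-neighbour : ∀ a b → residue ℓ (suc a , b) ≢ residue ℓ (a , b)
  lower-neighbour a b eq with residue-≡ ℓ (suc a) b a b eq (+-monoʳ-≤ b (n≤1+n a))
  ... | m , e = no-unit m (+-cancelˡ-≡ b _ _ (+-cancelʳ-≡ a _ _ (trans (+-assoc b 1 a) e)))

  module _ {ν μ y} (g : Grows ν μ y) (y-res : residue ℓ y ≡ i) where
    open Grows g

    -- Adding `y` can alter addability or removability only at `y` and at the boxes next to it,
    -- whose residues differ from `i`; hence among `i`-boxes just `y` changes its sign. The same
    -- reason carries the three lemmas that follow.
    addable-up : ∀ {x} → residue ℓ x ≡ i → x ≢ y → Addable ν x → Addable μ x
    addable-up {c , d} x-res x≢y ad with addable⇒corner ν _ ad
    ... | eq , longer with c ≟ proj₁ y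
    ...   | yes refl = contradiction (cong (c ,_) (trans (sym eq) old)) x≢y
    ...   | no c≢a   = corner⇒addable μ _ (trans (same c≢a) eq , above c longer)
      where
      above : ∀ c → LongerAbove ν c d → LongerAbove μ c d
      above zero    _ = tt
      above (suc c) p with c ≟ proj₁ y
      ... | no c≢a   = ≤-trans p (≤-reflexive (sym (same c≢a)))
      ... | yes refl = ≤-trans (m≤n⇒m≤1+n (≤-trans p (≤-reflexive old))) (≤-reflexive (sym new))

    addable-down : ∀ {x} → residue ℓ x ≡ i → Addable μ x → Addable ν x
    addable-down {c , d} x-res ad with addable⇒corner μ _ ad
    ... | eq , longer with c ≟ proj₁ y
    ...   | yes refl with refl ← trans (sym eq) new =
      contradiction (trans y-res (sym x-res)) (right-neighbour (proj₁ y) (proj₂ y))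
    ...   | no c≢a   = corner⇒addable ν _ (trans (sym (same c≢a)) eq , above c x-res longer)
      where
      above : ∀ c → residue ℓ (c , d) ≡ i → LongerAbove μ c d → LongerAbove ν c d
      above zero    _     _ = tt
      above (suc c) x-res p with c ≟ proj₁ y
      ... | no c≢a   = ≤-trans p (≤-reflexive (same c≢a))
      ... | yes refl with d ≟ proj₂ y
      ...   | yes refl = contradiction (trans x-res (sym y-res)) (lower-neighbour c d)
      ...   | no d≢b   = ≤-trans (≤∧≢⇒< (≤-pred (≤-trans p (≤-reflexive new))) d≢b) (≤-reflexive (sym old))

    removable-up : ∀ {x} → residue ℓ x ≡ i → Removable ν x → Removable μ x
    removable-up {c , d} x-res rm with removable⇒corner ν _ rm
    ... | eq , below with c ≟ proj₁ y
    ...   | yes refl with refl ← trans (sym old) eq =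
      contradiction (trans x-res (sym y-res)) (right-neighbour c d)
    ...   | no c≢a with suc c ≟ proj₁ y
    ...     | no c′≢a  = corner⇒removable μ _ (trans (same c≢a) eq , ≤-trans (≤-reflexive (same c′≢a)) below)
    ...     | yes refl with d ≟ proj₂ y
    ...       | yes refl = contradiction (trans y-res (sym x-res)) (lower-neighbour c d)
    ...       | no d≢b   = corner⇒removable μ _
      (trans (same c≢a) eq ,
       ≤-trans (≤-reflexive new) (≤∧≢⇒< (≤-trans (≤-reflexive (sym old)) below) (≢-sym d≢b)))

    removable-down : ∀ {x} → x ≢ y → Removable μ x → Removable ν x
    removable-down {c , d} x≢y rm with removable⇒corner μ _ rm
    ... | eq , below with c ≟ proj₁ y
    ...   | yes refl = contradiction (cong (c ,_) (suc-injective (trans (sym eq) new))) x≢y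
    ...   | no c≢a   = corner⇒removable ν _ (trans (sym (same c≢a)) eq , ≤-trans next below)
      where
      next : row ν (suc c) ≤ row μ (suc c)
      next with suc c ≟ proj₁ y
      ... | yes refl = ≤-trans (≤-reflexive old) (≤-trans (n≤1+n _) (≤-reflexive (sym new)))
      ... | no ne    = ≤-reflexive (sym (same ne))

  -- Letters and the lists of signs

  box : ∀ {ν} → Letter ν → Box
  box (minus x _) = x
  box (plus x _)  = x

  letter-box : ∀ {ν x s} → letter ℓ i ν x ≡ just s → box s ≡ x
  letter-box {ν} {x} eq with residue ℓ x ≟ i | removable? ν x | addable? ν x
  letter-box refl | yes _ | yes _ | _     = refl
  letter-box refl | yes _ | no _  | yes _ = refl

  letter-residue : ∀ {ν x s} → letter ℓ i ν x ≡ just s → residue ℓ (box s) ≡ i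
  letter-residue {ν} {x} eq with residue ℓ x ≟ i | removable? ν x | addable? ν x
  letter-residue refl | yes r | yes _ | _     = r
  letter-residue refl | yes r | no _  | yes _ = r

  -- The letter carries the proof found by `addable?`, which may differ from the given one; hence
  -- the existential.
  letter-plus : ∀ {ν x} → residue ℓ x ≡ i → Addable ν x → ∃ λ a → letter ℓ i ν x ≡ just (plus x a)
  letter-plus {ν} {x} r ad with residue ℓ x ≟ i | removable? ν x | addable? ν x
  ... | no ¬r | _      | _      = contradiction r ¬r
  ... | yes _ | yes rm | _      = contradiction (proj₁ rm) (proj₁ ad)
  ... | yes _ | no _   | no ¬ad = contradiction ad ¬ad
  ... | yes _ | no _   | yes a  = a , refl

  letter-minus : ∀ {ν x} → residue ℓ x ≡ i → Removable ν x → ∃ λ r → letter ℓ i ν x ≡ just (minus x r)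
  letter-minus {ν} {x} r rm with residue ℓ x ≟ i | removable? ν x | addable? ν x
  ... | no ¬r | _      | _ = contradiction r ¬r
  ... | yes _ | no ¬rm | _ = contradiction rm ¬rm
  ... | yes _ | yes q  | _ = q , refl

  module _ (ν : Partition) where

    signature-sorted : AllPairs (_≺_ on box) (signature ℓ i ν)
    signature-sorted = mapMaybe-AllPairs (letter ℓ i ν) box letter-box (positions-sorted ν)

    signature-residue : ∀ {s} → s ∈ˡ signature ℓ i ν → residue ℓ (box s) ≡ i
    signature-residue s∈ =
      let (_ , _ , eq) = ∈-mapMaybe⁻ (letter ℓ i ν) (positions ν) s∈ in letter-residue eq

  module _ {ν : Partition} where

    pluses-sorted : ∀ {w : Word ν} → AllPairs (_≺_ on box) w → AllPairs (_≺_ on proj₁) (pluses w)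
    pluses-sorted {[]}              _          = []
    pluses-sorted {minus _ _ ∷ _}   (_ ∷ pxs)  = pluses-sorted pxs
    pluses-sorted {plus x _ ∷ w}    (px ∷ pxs) = go w px ∷ pluses-sorted pxs
      where
      go : ∀ w → All (λ s → x ≺ box s) w → All (λ q → x ≺ proj₁ q) (pluses w)
      go []             _        = []
      go (minus _ _ ∷ w) (_ ∷ ps) = go w ps
      go (plus _ _ ∷ w)  (p ∷ ps) = p ∷ go w ps

    minuses-sorted : ∀ {w : Word ν} → AllPairs (_≺_ on box) w → AllPairs (_≺_ on proj₁) (minuses w)
    minuses-sorted {[]}             _          = []
    minuses-sorted {plus _ _ ∷ _}   (_ ∷ pxs)  = minuses-sorted pxs
    minuses-sorted {minus x _ ∷ w}  (px ∷ pxs) = go w px ∷ minuses-sorted pxs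
      where
      go : ∀ w → All (λ s → x ≺ box s) w → All (λ q → x ≺ proj₁ q) (minuses w)
      go []             _        = []
      go (plus _ _ ∷ w)  (_ ∷ ps) = go w ps
      go (minus _ _ ∷ w) (p ∷ ps) = p ∷ go w ps

    ∈-pluses⁺ : ∀ {x a} {w : Word ν} → plus x a ∈ˡ w → (x , a) ∈ˡ pluses w
    ∈-pluses⁺ p = ∈-mapMaybe⁺ _ p refl

    ∈-pluses⁻ : ∀ {x a} (w : Word ν) → (x , a) ∈ˡ pluses w → plus x a ∈ˡ w
    ∈-pluses⁻ w p with ∈-mapMaybe⁻ _ w p
    ... | plus _ _ , q , refl = q

    ∈-minuses⁺ : ∀ {x r} {w : Word ν} → minus x r ∈ˡ w → (x , r) ∈ˡ minuses w
    ∈-minuses⁺ p = ∈-mapMaybe⁺ _ p refl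

    ∈-minuses⁻ : ∀ {x r} (w : Word ν) → (x , r) ∈ˡ minuses w → minus x r ∈ˡ w
    ∈-minuses⁻ w p with ∈-mapMaybe⁻ _ w p
    ... | minus _ _ , q , refl = q

  -- Read from bottom to top, this makes the signature a row of pluses followed by minuses before
  -- any cancellation.
  Separated : Partition → Set
  Separated ν = ∀ {x y} → residue ℓ x ≡ i → Removable ν x → residue ℓ y ≡ i → Addable ν y → proj₁ x < proj₁ y

  opaque

    -- The proofs attached to the letters are dropped, so that the lists of different partitions can
    -- be compared box by box.
    addables removables : Partition → List Box
    addables ν   = map proj₁ (pluses (signature ℓ i ν))
    removables ν = map proj₁ (minuses (signature ℓ i ν))

    addables-sorted : ∀ ν → AllPairs _≺_ (addables ν)
    addables-sorted ν = AllPairs.map⁺ (pluses-sorted (signature-sorted ν))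

    removables-sorted : ∀ ν → AllPairs _≺_ (removables ν)
    removables-sorted ν = AllPairs.map⁺ (minuses-sorted (signature-sorted ν))

    ∈-addables : ∀ ν x → x ∈ˡ addables ν ⇔ (residue ℓ x ≡ i × Addable ν x)
    ∈-addables ν x = mk⇔ fwd bwd
      where
      fwd : x ∈ˡ addables ν → residue ℓ x ≡ i × Addable ν x
      fwd x∈ with ∈-map⁻ proj₁ x∈
      ... | (_ , a) , p , refl = signature-residue ν (∈-pluses⁻ (signature ℓ i ν) p) , a
      bwd : residue ℓ x ≡ i × Addable ν x → x ∈ˡ addables ν
      bwd (r , ad) = let (a , eq) = letter-plus r ad in
        ∈-map⁺ proj₁ (∈-pluses⁺ (∈-mapMaybe⁺ (letter ℓ i ν) (addable-position ν ad) eq))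

    ∈-removables : ∀ ν x → x ∈ˡ removables ν ⇔ (residue ℓ x ≡ i × Removable ν x)
    ∈-removables ν x = mk⇔ fwd bwd
      where
      fwd : x ∈ˡ removables ν → residue ℓ x ≡ i × Removable ν x
      fwd x∈ with ∈-map⁻ proj₁ x∈
      ... | (_ , a) , p , refl = signature-residue ν (∈-minuses⁻ (signature ℓ i ν) p) , a
      bwd : residue ℓ x ≡ i × Removable ν x → x ∈ˡ removables ν
      bwd (r , rm) = let (a , eq) = letter-minus r rm in
        ∈-map⁺ proj₁ (∈-minuses⁺ (∈-mapMaybe⁺ (letter ℓ i ν) (removable-position ν rm) eq))

    -- A minus cancels only against a plus to its right, which would lie in the same row or higher,
    -- against `Separated`.
    reduced : ∀ ν → Separated ν → reduce (signature ℓ i ν) ≡ signature ℓ i ν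
    reduced ν sep = go (signature ℓ i ν) (signature-sorted ν) (All.tabulate (signature-residue ν))
      where
      go : ∀ (w : Word ν) → AllPairs (_≺_ on box) w → All (λ s → residue ℓ (box s) ≡ i) w → reduce w ≡ w
      go []      _          _        = refl
      go (s ∷ w) (px ∷ pxs) (r ∷ rs) = trans (cong (cancel s) (go w pxs rs)) (keep s w px r rs)
        where
        keep : ∀ (s : Letter ν) w → All (λ t → box s ≺ box t) w → residue ℓ (box s) ≡ i →
               All (λ t → residue ℓ (box t) ≡ i) w → cancel s w ≡ s ∷ w
        keep (plus _ _)  _                _       _ _       = refl
        keep (minus _ _) []               _       _ _       = refl
        keep (minus _ _) (minus _ _ ∷ _)  _       _ _       = refl
        keep (minus _ p) (plus _ q ∷ _)   (lt ∷ _) r (r′ ∷ _) = contradiction (≺⇒≥ lt) (<⇒≱ (sep r p r′ q))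

    conormal-reduced : ∀ ν → Separated ν → conormal ℓ i ν ≡ pluses (signature ℓ i ν)
    conormal-reduced ν sep = cong pluses (reduced ν sep)

    normal-reduced : ∀ ν → Separated ν → normal ℓ i ν ≡ minuses (signature ℓ i ν)
    normal-reduced ν sep = cong minuses (reduced ν sep)

    φ-addables : ∀ ν → Separated ν → φᵢ ℓ i ν ≡ length (addables ν)
    φ-addables ν sep = trans (cong length (conormal-reduced ν sep)) (sym (length-map proj₁ (pluses (signature ℓ i ν))))

    ε-removables : ∀ ν → Separated ν → εᵢ ℓ i ν ≡ length (removables ν)
    ε-removables ν sep = trans (cong length (normal-reduced ν sep)) (sym (length-map proj₁ (minuses (signature ℓ i ν))))

    -- Nothing cancels, so the cogood box carries the last plus of the whole signature, which is
    -- read upwards.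
    last-conormal : ∀ ν {p} → Separated ν → last (conormal ℓ i ν) ≡ just p →
      residue ℓ (proj₁ p) ≡ i × (∀ {z} → residue ℓ z ≡ i → Addable ν z → proj₁ (proj₁ p) ≤ proj₁ z)
    last-conormal ν {y , _} sep last≡ = proj₁ (to (∈-addables ν y) (proj₁ top)) ,
      λ {z} r az → bound (proj₂ top (from (∈-addables ν z) (r , az)))
      where
      top : y ∈ˡ addables ν × (∀ {z} → z ∈ˡ addables ν → z ≡ y ⊎ z ≺ y)
      top = last-final (addables-sorted ν)
        (last-map proj₁ {xs = pluses (signature ℓ i ν)} (trans (cong last (sym (conormal-reduced ν sep))) last≡))
      bound : ∀ {z} → z ≡ y ⊎ z ≺ y → proj₁ y ≤ proj₁ z
      bound (inj₁ refl) = ≤-refl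
      bound (inj₂ z≺y)  = ≺⇒≥ z≺y

    -- Likewise the good box carries the first minus of the whole signature.
    head-normal : ∀ ν {p} → Separated ν → head (normal ℓ i ν) ≡ just p →
      residue ℓ (proj₁ p) ≡ i × (∀ {z} → residue ℓ z ≡ i → Removable ν z → proj₁ z ≤ proj₁ (proj₁ p))
    head-normal ν {y , _} sep head≡ = proj₁ (to (∈-removables ν y) (proj₁ bottom)) ,
      λ {z} r rz → bound (proj₂ bottom (from (∈-removables ν z) (r , rz)))
      where
      bottom : y ∈ˡ removables ν × (∀ {z} → z ∈ˡ removables ν → z ≡ y ⊎ y ≺ z)
      bottom = head-first (removables-sorted ν)
        (head-map proj₁ {xs = minuses (signature ℓ i ν)} (trans (cong head (sym (normal-reduced ν sep))) head≡))
      bound : ∀ {z} → z ≡ y ⊎ y ≺ z → proj₁ z ≤ proj₁ y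
      bound (inj₁ refl) = ≤-refl
      bound (inj₂ y≺z)  = ≺⇒≥ y≺z

  -- Change of the signs in one step

  module _ {ν μ y} (g : Grows ν μ y) (y-res : residue ℓ y ≡ i) where

    -- As sets, the addable `i`-boxes of `ν` are `y` and those of `μ`; distinctness turns this into
    -- a count.
    addables-length : length (addables ν) ≡ suc (length (addables μ))
    addables-length = unique-length (AllPairs.map ≺⇒≢ (addables-sorted ν))
      (All.tabulate (λ { z∈ refl → grown-not-addable g (proj₂ (to (∈-addables μ y) z∈)) })
        ∷ AllPairs.map ≺⇒≢ (addables-sorted μ))
      λ z → mk⇔ (fwd z (z ≟ᵇ y)) (bwd z)
      where
      fwd : ∀ z → Dec (z ≡ y) → z ∈ˡ addables ν → z ∈ˡ y ∷ addables μ
      fwd z (yes e)  _  = here e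
      fwd z (no z≢y) z∈ = let (r , ad) = to (∈-addables ν z) z∈ in
        there (from (∈-addables μ z) (r , addable-up g y-res r z≢y ad))
      bwd : ∀ z → z ∈ˡ y ∷ addables μ → z ∈ˡ addables ν
      bwd z (here refl) = from (∈-addables ν z) (y-res , grows⇒addable g)
      bwd z (there z∈)  = let (r , ad) = to (∈-addables μ z) z∈ in
        from (∈-addables ν z) (r , addable-down g y-res r ad)

    removables-length : length (removables μ) ≡ suc (length (removables ν))
    removables-length = unique-length (AllPairs.map ≺⇒≢ (removables-sorted μ))
      (All.tabulate (λ { z∈ refl → ungrown-not-removable g (proj₂ (to (∈-removables ν y) z∈)) })
        ∷ AllPairs.map ≺⇒≢ (removables-sorted ν))
      λ z → mk⇔ (fwd z (z ≟ᵇ y)) (bwd z)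
      where
      fwd : ∀ z → Dec (z ≡ y) → z ∈ˡ removables μ → z ∈ˡ y ∷ removables ν
      fwd z (yes e)  _  = here e
      fwd z (no z≢y) z∈ = let (r , rm) = to (∈-removables μ z) z∈ in
        there (from (∈-removables ν z) (r , removable-down g y-res z≢y rm))
      bwd : ∀ z → z ∈ˡ y ∷ removables ν → z ∈ˡ removables μ
      bwd z (here refl) = from (∈-removables μ z) (y-res , grows⇒removable g)
      bwd z (there z∈)  = let (r , rm) = to (∈-removables ν z) z∈ in
        from (∈-removables μ z) (r , removable-up g y-res r rm)

  -- The larger partition is `μ`, whichever operator made the step.
  record Step (ν μ : Partition) : Set where
    field
      separated  : Separated ν
      separated′ : Separated μ
      φ-step     : φᵢ ℓ i ν ≡ suc (φᵢ ℓ i μ)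
      ε-step     : εᵢ ℓ i μ ≡ suc (εᵢ ℓ i ν)

  mkStep : ∀ ν μ y → Grows ν μ y → residue ℓ y ≡ i → Separated ν → Separated μ → Step ν μ
  mkStep ν μ y g r sep sep′ = record
    { separated  = sep
    ; separated′ = sep′
    ; φ-step = trans (φ-addables ν sep) (trans (addables-length g r) (cong suc (sym (φ-addables μ sep′))))
    ; ε-step = trans (ε-removables μ sep′) (trans (removables-length g r) (cong suc (sym (ε-removables ν sep))))
    }

  same-row-addable : ∀ ν {x y} → Addable ν x → Addable ν y → proj₁ x ≡ proj₁ y → x ≡ y
  same-row-addable ν ad ad′ refl =
    cong (_ ,_) (trans (sym (proj₁ (addable⇒corner ν _ ad))) (proj₁ (addable⇒corner ν _ ad′)))

  same-row-removable : ∀ ν {x y} → Removable ν x → Removable ν y → proj₁ x ≡ proj₁ y → x ≡ y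
  same-row-removable ν rm rm′ refl =
    cong (_ ,_) (suc-injective (trans (sym (proj₁ (removable⇒corner ν _ rm))) (proj₁ (removable⇒corner ν _ rm′))))

  -- The box `y` is the topmost addable `i`-box and a row has only one addable box, so every
  -- remaining plus lies strictly below the new minus at `y`.
  f-step : ∀ ν μ → Separated ν → f̃ ℓ i ν ≡ just μ → Step ν μ
  f-step ν μ sep eq with map-just⁻ (last (conormal ℓ i ν)) eq
  ... | (y , ad) , last≡ , refl = mkStep ν μ y g y-res sep sep′
    where
    g : Grows ν μ y
    g = addable⇒grows ν ad
    y-res : residue ℓ y ≡ i
    y-res = proj₁ (last-conormal ν sep last≡)
    sep′ : Separated μ
    sep′ {x} {z} rx rm rz az with x ≟ᵇ y
    ... | no x≢y   = sep rx (removable-down g y-res x≢y rm) rz (addable-down g y-res rz az)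
    ... | yes refl = ≤∧≢⇒< (proj₂ (last-conormal ν sep last≡) rz az′) λ e →
      grown-not-addable g (subst (Addable μ) (sym (same-row-addable ν ad az′ e)) az)
      where
      az′ = addable-down g y-res rz az

  -- The box `y` is the lowest removable `i`-box and a row has only one, so every remaining minus
  -- lies strictly above the new plus at `y`.
  e-step : ∀ ν μ → Separated μ → ẽ ℓ i μ ≡ just ν → Step ν μ
  e-step ν μ sep eq with map-just⁻ (head (normal ℓ i μ)) eq
  ... | (y , rm) , head≡ , refl = mkStep ν μ y g y-res sep′ sep
    where
    g : Grows ν μ y
    g = removable⇒grows μ rm
    y-res : residue ℓ y ≡ i
    y-res = proj₁ (head-normal μ sep head≡)
    sep′ : Separated ν
    sep′ {x} {z} rx rx′ rz az with z ≟ᵇ y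
    ... | no z≢y   = sep rx (removable-up g y-res rx rx′) rz (addable-up g y-res rz z≢y az)
    ... | yes refl = ≤∧≢⇒< (proj₂ (head-normal μ sep head≡) rx rx″) λ e →
      ungrown-not-removable g (subst (Removable ν) (same-row-removable μ rx″ rm e) rx′)
      where
      rx″ = removable-up g y-res rx rx′

  f-steps : ∀ k ν μ → Separated ν → f̃ ℓ i ^[ k ] ν ≡ just μ →
            Separated μ × φᵢ ℓ i ν ≡ k + φᵢ ℓ i μ × εᵢ ℓ i μ ≡ k + εᵢ ℓ i ν
  f-steps zero    ν μ sep refl = sep , refl , refl
  f-steps (suc k) ν μ sep eq =
    let (κ , eqκ , eqμ)   = >>=-just⁻ (f̃ ℓ i ^[ k ] ν) eq
        (sepκ , φ≡ , ε≡)  = f-steps k ν κ sep eqκ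
        st                = f-step κ μ sepκ eqμ
    in Step.separated′ st , trans φ≡ (trans (cong (k +_) (Step.φ-step st)) (+-suc k _)) ,
       trans (Step.ε-step st) (cong suc ε≡)

  e-steps : ∀ k ν μ → Separated ν → ẽ ℓ i ^[ k ] ν ≡ just μ →
            Separated μ × εᵢ ℓ i ν ≡ k + εᵢ ℓ i μ × φᵢ ℓ i μ ≡ k + φᵢ ℓ i ν
  e-steps zero    ν μ sep refl = sep , refl , refl
  e-steps (suc k) ν μ sep eq =
    let (κ , eqκ , eqμ)   = >>=-just⁻ (ẽ ℓ i ^[ k ] ν) eq
        (sepκ , ε≡ , φ≡)  = e-steps k ν κ sep eqκ
        st                = e-step μ κ sepκ eqμ
    in Step.separated st , trans ε≡ (trans (cong (k +_) (Step.ε-step st)) (+-suc k _)) ,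
       trans (Step.φ-step st) (cong suc φ≡)

  -- ℓ-partitions and signs

  0<ℓ : 0 < ℓ
  0<ℓ = <-trans (s≤s z≤n) 2≤ℓ

  -- Otherwise a removable `i`-box `(a , b)` lies below an addable `i`-box `(c , d)`, since in a
  -- common row they would be neighbours. In column `b` the hook length is 1 in row `a` and, by the
  -- equal residues, a multiple of `ℓ` in row `c`: a crossing.
  separated : ∀ ν → HookFree ℓ ν → Separated ν
  separated ν free {a , b} {c , d} rx rm ry ad
    with removable⇒corner ν _ rm | addable⇒corner ν _ ad | <-cmp a c
  ... | _ | _ | tri< a<c _ _ = a<c
  ... | end , _ | end′ , _ | tri≈ _ refl _ with refl ← trans (sym end′) end =
    contradiction (trans rx (sym ry)) (right-neighbour a b)
  ... | end , next | end′ , _ | tri> _ _ c<a = contradiction record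
      -- The shift `a` puts the bead of row `a` at `suc b`, one above the vacancy `b`.
      { p = a ; q = c ; s = c ; free = free ; vac = vac
      ; above = +-monoˡ-< a (≤-reflexive (sym end))
      ; off   = λ m e → no-unit m (+-cancelˡ-≡ b _ _ (trans (+-comm b 1)
                  (+-cancelʳ-≡ a _ _ (trans (cong (_+ a) (sym end)) e))))
      ; q<p   = c<a ; on-q = on-c ; on-s = on-c
      } (no-crossing 0<ℓ a (proj₁ quotient) ≤-refl ≤-refl)
    where
    b≤d : b ≤ d
    b≤d = ≤-trans (n≤1+n b) (≤-trans (≤-reflexive (sym end)) (≤-trans (row-anti ν (<⇒≤ c<a)) (≤-reflexive end′)))
    quotient = residue-≡ ℓ a b c d (trans rx (sym ry)) (+-mono-≤ b≤d (<⇒≤ c<a))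
    on-c : row ν c + a ≡ b + proj₁ quotient * ℓ + c
    on-c = trans (cong (_+ a) end′) (proj₂ quotient)
    -- Rows up to `a` reach beyond column `b - 1` by at least one box and later rows do not, so no
    -- bead is at `b`.
    vac : Vacant ν a b
    vac j e with j ≤? a
    ... | yes j≤a = <-irrefl (sym e) (+-mono-<-≤ (≤-trans (≤-reflexive (sym end)) (row-anti ν j≤a)) j≤a)
    ... | no j≰a  = <-irrefl e (+-mono-≤-< (≤-trans (row-anti ν (≰⇒> j≰a)) next) (≰⇒> j≰a))

  longer-above : ∀ ν {a b c} → LongerAbove ν a b → c < a → b < row ν c
  longer-above ν {suc a} longer (s≤s c≤a) = ≤-trans longer (row-anti ν c≤a)

  -- The vacancy to the right of the bead of x, the bead of y, and the bead of z cross.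
  not-hookfree : ∀ ν x y z → residue ℓ x ≡ i → Addable ν x → residue ℓ y ≡ i → Addable ν y →
    residue ℓ z ≡ i → Removable ν z → proj₁ z < proj₁ y → proj₁ y < proj₁ x → ¬ HookFree ℓ ν
  not-hookfree ν (a , b) (c , d) (e , f) rx ax ry ay rz rmz e<c c<a free
    with addable⇒corner ν _ ax | addable⇒corner ν _ ay | removable⇒corner ν _ rmz
  ... | end-a , longer-a | end-c , _ | end-e , _ = no-crossing 0<ℓ a (proj₁ quotient) ≤-refl ≤-refl record
      -- With the shift `a`, the bead of row `a` is at `b`. The bead of row `e` is congruent to
      -- `suc b` and that of row `c` to `b`: the box `z` belongs to the diagram and `y` does not,
      -- which accounts for the difference of 1.
      { p = c ; q = e ; s = e ; free = free ; vac = vac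
      ; above = +-mono-≤-< (longer-above ν longer-a c<a) c<a
      ; off   = off
      ; q<p   = e<c ; on-q = on-e ; on-s = on-e
      }
    where
    e<a : e < a
    e<a = <-trans e<c c<a
    quotient = residue-≡ ℓ a b e f (trans rx (sym rz))
      (+-mono-≤ (≤-pred (≤-trans (longer-above ν longer-a e<a) (≤-reflexive end-e))) (<⇒≤ e<a))
    on-e : row ν e + a ≡ suc b + proj₁ quotient * ℓ + e
    on-e = trans (cong (_+ a) end-e) (cong suc (proj₂ quotient))
    off : ∀ m → row ν c + a ≢ suc b + m * ℓ + c
    off m p with residue-≡ ℓ a b c d (trans rx (sym ry))
      (+-mono-≤ (≤-trans (<⇒≤ (longer-above ν longer-a c<a)) (≤-reflexive end-c)) (<⇒≤ c<a))
    -- Both congruences together would make `ℓ` divide 1.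
    ... | m′ , p′ = <-irrefl (sym (∣1⇒≡1 (∣m+n∣m⇒∣n {m = m * ℓ} (divides m′ 1+mℓ≡m′ℓ) (divides m refl)))) 2≤ℓ
      where
      1+mℓ≡m′ℓ : m * ℓ + 1 ≡ m′ * ℓ
      1+mℓ≡m′ℓ = trans (+-comm (m * ℓ) 1) (+-cancelˡ-≡ b _ _ (trans (+-suc b (m * ℓ))
        (+-cancelʳ-≡ c _ _ (trans (sym p) (trans (cong (_+ a) end-c) p′)))))
    vac : Vacant ν a (suc b)
    vac j p with j <? a
    ... | yes j<a = <-irrefl (sym p) (+-mono-≤-< (longer-above ν longer-a j<a) j<a)
    ... | no j≮a  = <-irrefl p (+-mono-<-≤ (s≤s (≤-trans (row-anti ν (≮⇒≥ j≮a)) (≤-reflexive end-a))) (≮⇒≥ j≮a))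

  -- The two lowest addable `i`-boxes serve as `x` and `y`, in different rows because a row has only
  -- one addable box; by `Separated` any removable `i`-box lies above both.
  few-signs : ∀ ν → Separated ν → 2 ≤ φᵢ ℓ i ν → 1 ≤ εᵢ ℓ i ν → ¬ HookFree ℓ ν
  few-signs ν sep 2≤φ 1≤ε =
    go _ refl _ refl (≤-trans 2≤φ (≤-reflexive (φ-addables ν sep))) (≤-trans 1≤ε (≤-reflexive (ε-removables ν sep)))
       (addables-sorted ν)
    where
    go : ∀ as → as ≡ addables ν → ∀ rs → rs ≡ removables ν → 2 ≤ length as → 1 ≤ length rs →
         AllPairs _≺_ (addables ν) → ¬ HookFree ℓ ν
    go (_ ∷ []) _ _ _ (s≤s ())
    go (x ∷ y ∷ _) eqa (z ∷ _) eqr _ _ sorted =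
      let (rx , ax) = to (∈-addables ν x) (subst (x ∈ˡ_) eqa (here refl))
          (ry , ay) = to (∈-addables ν y) (subst (y ∈ˡ_) eqa (there (here refl)))
          (rz , rmz) = to (∈-removables ν z) (subst (z ∈ˡ_) eqr (here refl))
      in not-hookfree ν x y z rx ax ry ay rz rmz (sep rz rmz ry ay)
           (higher ax ay (subst (AllPairs _≺_) (sym eqa) sorted))
      where
      higher : ∀ {x y zs} → Addable ν x → Addable ν y → AllPairs _≺_ (x ∷ y ∷ zs) → proj₁ y < proj₁ x
      higher ax ay ((inj₁ p ∷ _) ∷ _) = p
      higher ax ay ((q@(inj₂ (e , _)) ∷ _) ∷ _) = contradiction (same-row-addable ν ax ay e) (≺⇒≢ q)

-- Powers of `f̃` and `ẽ` applied to an `ℓ`-partition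

theorem2p4p2p3 : (ℓ : ℕ) .{{_ : NonZero ℓ}} → 2 ≤ ℓ →
    (ν : Partition) → IsℓPartition ℓ ν →
    (i : ℕ) → i < ℓ →
    (∀ k → 0 < k → k < φᵢ ℓ i ν ∸ 1 → ¬ Any (IsℓPartition ℓ) (f̃ ℓ i ^[ k ] ν)) ×
    (∀ k → 1 < k → k < εᵢ ℓ i ν → ¬ Any (IsℓPartition ℓ) (ẽ ℓ i ^[ k ] ν))
theorem2p4p2p3 ℓ 2≤ℓ ν isℓ i _ = f-part , e-part
  where
  open Crystal ℓ 2≤ℓ i
  sep : Separated ν
  sep = separated ν (IsℓPartition.noHookRemoved isℓ)

  f-part : ∀ k → 0 < k → k < φᵢ ℓ i ν ∸ 1 → ¬ Any (IsℓPartition ℓ) (f̃ ℓ i ^[ k ] ν)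
  f-part k 0<k k<φ any with Any-just⁻ any
  ... | μ , eq , isℓμ with f-steps k ν μ sep eq
  ...   | sepμ , φ≡ , ε≡ = few-signs μ sepμ 2≤φ 1≤ε (IsℓPartition.noHookRemoved isℓμ)
    where
    -- From `k < φ - 1` at least two pluses are left, and `0 < k` steps have produced a minus.
    2≤φ : 2 ≤ φᵢ ℓ i μ
    2≤φ = +-cancelˡ-≤ k 2 _ (begin
      k + 2           ≡⟨ +-comm k 2 ⟩
      2 + k           ≤⟨ m<n∸o⇒m+o<n k<φ ⟩
      φᵢ ℓ i ν        ≡⟨ φ≡ ⟩
      k + φᵢ ℓ i μ    ∎)
      where
      open ≤-Reasoning
      m<n∸o⇒m+o<n : ∀ {n} → k < n ∸ 1 → 2 + k ≤ n
      m<n∸o⇒m+o<n {suc n} p = s≤s p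
    1≤ε : 1 ≤ εᵢ ℓ i μ
    1≤ε = ≤-trans 0<k (≤-trans (m≤m+n k _) (≤-reflexive (sym ε≡)))

  e-part : ∀ k → 1 < k → k < εᵢ ℓ i ν → ¬ Any (IsℓPartition ℓ) (ẽ ℓ i ^[ k ] ν)
  e-part k 1<k k<ε any with Any-just⁻ any
  ... | μ , eq , isℓμ with e-steps k ν μ sep eq
  ...   | sepμ , ε≡ , φ≡ = few-signs μ sepμ
    -- Here `1 < k` steps have produced at least two pluses, and `k < ε` leaves a minus.
    (≤-trans 1<k (≤-trans (m≤m+n k _) (≤-reflexive (sym φ≡))))
    (+-cancelˡ-≤ k 1 _ (≤-trans (≤-reflexive (+-comm k 1)) (≤-trans k<ε (≤-reflexive ε≡))))
    (IsℓPartition.noHookRemoved isℓμ)
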